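{- For every integer $k\ge 0$, every outer $k$-planar graph has separation number at most $k+2$. Moreover, for every integer $k \ge 1$, every outer min-$k$-planar graph has separation number at most $2k+1$.
   Context: A convex drawing of a finite simple graph $G$ places the vertices at distinct points of a circle and draws every edge as a straight-line segment. A convex drawing is outer $k$-planar if every edge crosses at most $k$ other edges; it is outer min-$k$-planar if for every pair of crossing edges at least one of them is crossed by at most $k$ edges in total. A graph is outer $k$-planar (resp. outer min-$k$-planar) if it admits such a drawing. A pair $(A,B)$ of vertex sets of a graph $H$ with $n$ vertices is a separation if $A\cup B=V(H)$ and there is no edge between $A\setminus B$ and $B\setminus A$; it is balanced if $|A\setminus B|\le 2n/3$ and $|B\setminus A|\le 2n/3$; its order is $|A\cap B|$. The separation number $\mathrm{sn}(G)$ is the minimum integer $s$ such that every subgraph of $G$ has a balanced separation of order at most $s$. -}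

module Defs where

open import Data.Nat using (ℕ; zero; suc; _+_; _*_; _≤_; _<ᵇ_)
open import Data.Bool using (Bool; true; false; _∧_; _∨_; not; if_then_else_)
open import Data.Fin using (Fin; toℕ)
open import Data.Fin.Subset using (Subset; _∈_; _∉_; _⊆_; _∩_; _∪_; _─_; ∣_∣)
open import Data.Fin.Permutation using (Permutation′; _⟨$⟩ʳ_)
open import Data.Product using (Σ; ∃; _×_)
open import Data.Sum using (_⊎_)
open import Relation.Binary.PropositionalEquality using (_≡_)

record Graph (n : ℕ) : Set where
  field
    adj    : Fin n → Fin n → Bool
    sym    : ∀ u v → adj u v ≡ adj v u
    irrefl : ∀ v → adj v v ≡ false
open Graph public

count : {n : ℕ} → (Fin n → Bool) → ℕ
count {zero}  p = 0
count {suc n} p = (if p Fin.zero then 1 else 0) + count (λ i → p (Fin.suc i))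
  where import Data.Fin as Fin

sumFin : {n : ℕ} → (Fin n → ℕ) → ℕ
sumFin {zero}  f = 0
sumFin {suc n} f = f Fin.zero + sumFin (λ i → f (Fin.suc i))
  where import Data.Fin as Fin

-- A convex drawing: the vertices are placed at distinct points of a circle.
-- Only the cyclic order of the points matters for crossings, so a convex
-- drawing is given by a bijection from vertices to positions 0..n-1 along the circle.
ConvexDrawing : ℕ → Set
ConvexDrawing n = Permutation′ n

pos : {n : ℕ} → ConvexDrawing n → Fin n → ℕ
pos π v = toℕ (π ⟨$⟩ʳ v)

min′ max′ : ℕ → ℕ → ℕ
min′ a b = if a <ᵇ b then a else b
max′ a b = if a <ᵇ b then b else a

inside outside : ℕ → ℕ → ℕ → Bool
inside a b c = (min′ a b <ᵇ c) ∧ (c <ᵇ max′ a b)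
outside a b c = (c <ᵇ min′ a b) ∨ (max′ a b <ᵇ c)

-- Straight-line chords uv and xy of the convex drawing cross iff their
-- (distinct) endpoints interleave along the circle.
crosses : {n : ℕ} → ConvexDrawing n → Fin n → Fin n → Fin n → Fin n → Bool
crosses π u v x y =
  let a = pos π u ; b = pos π v ; c = pos π x ; d = pos π y in
  (inside a b c ∧ outside a b d) ∨ (outside a b c ∧ inside a b d)

crossNum : {n : ℕ} → Graph n → ConvexDrawing n → Fin n → Fin n → ℕ
crossNum G π u v =
  sumFin (λ x → count (λ y → (toℕ x <ᵇ toℕ y) ∧ adj G x y ∧ crosses π u v x y))

IsOuterKPlanarDrawing : {n : ℕ} → ℕ → Graph n → ConvexDrawing n → Set
IsOuterKPlanarDrawing k G π = ∀ u v → adj G u v ≡ true → crossNum G π u v ≤ k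

OuterKPlanar : {n : ℕ} → ℕ → Graph n → Set
OuterKPlanar k G = Σ (ConvexDrawing _) (IsOuterKPlanarDrawing k G)

IsOuterMinKPlanarDrawing : {n : ℕ} → ℕ → Graph n → ConvexDrawing n → Set
IsOuterMinKPlanarDrawing k G π =
  ∀ u v x y → adj G u v ≡ true → adj G x y ≡ true → crosses π u v x y ≡ true →
  (crossNum G π u v ≤ k) ⊎ (crossNum G π x y ≤ k)

OuterMinKPlanar : {n : ℕ} → ℕ → Graph n → Set
OuterMinKPlanar k G = Σ (ConvexDrawing _) (IsOuterMinKPlanarDrawing k G)

record Subgraph {n : ℕ} (G : Graph n) : Set where
  field
    verts  : Subset n
    hadj   : Fin n → Fin n → Bool
    hsym   : ∀ u v → hadj u v ≡ hadj v u
    hsub   : ∀ u v → hadj u v ≡ true → adj G u v ≡ true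
    hends  : ∀ u v → hadj u v ≡ true → u ∈ verts   -- (and v ∈ verts, by hsym)
open Subgraph public

IsSeparation : {n : ℕ} {G : Graph n} → Subgraph G → Subset n → Subset n → Set
IsSeparation H A B =
  (A ∪ B ≡ verts H) ×
  (∀ u v → hadj H u v ≡ true → u ∈ (A ─ B) → v ∉ (B ─ A))

IsBalanced : {n : ℕ} {G : Graph n} → Subgraph G → Subset n → Subset n → Set
IsBalanced H A B =
  (3 * ∣ A ─ B ∣ ≤ 2 * ∣ verts H ∣) × (3 * ∣ B ─ A ∣ ≤ 2 * ∣ verts H ∣)

SepNumAtMost : {n : ℕ} → ℕ → Graph n → Set
SepNumAtMost s G =
  (H : Subgraph G) → Σ (Subset _) λ A → Σ (Subset _) λ B →
    IsSeparation H A B × IsBalanced H A B × (∣ A ∩ B ∣ ≤ s)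

{-# OPTIONS --safe #-}

-- A chord pq crossed by few edges gives a separator made of p, q and one end of each
-- crossing edge.  Suppose that no such chord is balanced.  Then each chord with few crossings
-- has a small side, a closed arc carrying less than a third of the vertices, and three small
-- arcs never cover the circle.
--
-- Orient every edge along its small arc and let D p be the number of these arcs covering p.
-- A chord pq is crossed by at most D p + D q edges, and the ends of a maximal arc satisfy
-- D x + D y ≤ (crossings of xy).  Hence every point off P = {2 D ≤ k} is covered by a small arc
-- with an end in P, while chords within P have few crossings; this forces three small arcs
-- to cover the circle.
--
-- In the min-k-planar case the heavy edges, those with more than k crossings, are pairwise
-- noncrossing.  The maximal light arcs over the two ends of a heavy edge span chords with
-- fewer than 2k crossings, so some small arc contains both ends of the edge, which is thereby
-- oriented too.  The argument then runs with P = {D < k}.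
module Submission where

open import Defs hiding (sym; inside; outside)
import Defs
open import Algebra.Properties.CommutativeSemigroup using (interchange)
open import Data.Bool using (Bool; true; false; _∧_; _∨_; not; if_then_else_; T)
import Data.Bool as Bool
open import Data.Bool.Properties using (∧-comm; ∨-comm; ∧-identityʳ; ∧-zeroʳ; ¬-not)
open import Data.Empty using (⊥; ⊥-elim)
open import Data.Fin using (Fin; zero; suc; toℕ)
import Data.Fin.Properties as Fin
open import Data.Fin.Permutation using (_⟨$⟩ˡ_; inverseˡ)
open import Data.Fin.Properties using (any?; toℕ-injective)
open import Data.Fin.Subset using (Subset; _∈_; _∉_; _∩_; _─_; ∣_∣; inside; outside)
open import Data.Fin.Subset.Properties using (⊆-antisym; x∈p∪q⁻; x∈p∪q⁺; x∈p∩q⁻; p─q⊆p)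
open import Data.Nat
open import Data.Nat.Properties
open import Data.Product using (Σ; ∃; ∃₂; _×_; _,_; proj₁; proj₂)
open import Data.Sum using (_⊎_; inj₁; inj₂; [_,_]′)
import Data.Sum as Sum
open import Data.Vec using (Vec; []; _∷_; lookup; map; tabulate; here; there)
open import Data.Vec.Properties using (lookup-map; lookup∘tabulate; []=⇒lookup; lookup⇒[]=)
open import Function using (_∘_; id)
open import Relation.Binary.Definitions using (tri<; tri≈; tri>)
open import Relation.Binary.PropositionalEquality hiding ([_])
open import Relation.Nullary using (¬_; Dec; yes; no; does; ¬?)
open import Relation.Nullary.Decidable using (_×-dec_; _⊎-dec_; decidable-stable; dec-true)
open import Relation.Nullary.Reflects
  using (Reflects; ofʸ; ofⁿ; invert; _×-reflects_; _⊎-reflects_; _→-reflects_)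

-- Boolean connectives as propositions.

∧-true : ∀ {a b} → a ∧ b ≡ true → a ≡ true × b ≡ true
∧-true {true} h = refl , h

true-∧ : ∀ {a b} → a ≡ true → b ≡ true → a ∧ b ≡ true
true-∧ refl h = h

not-true : ∀ {b} → not b ≡ true → ¬ b ≡ true
not-true {false} _ ()

true-not : ∀ {b} → ¬ b ≡ true → not b ≡ true
true-not {false} _ = refl
true-not {true}  h = ⊥-elim (h refl)

∨-true : ∀ {a b} → a ∨ b ≡ true → a ≡ true ⊎ b ≡ true
∨-true {true}  _ = inj₁ refl
∨-true {false} h = inj₂ h

true-∨ˡ : ∀ {a b} → a ≡ true → a ∨ b ≡ true
true-∨ˡ refl = refl

true-∨ʳ : ∀ {a b} → b ≡ true → a ∨ b ≡ true
true-∨ʳ {true}  _ = refl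
true-∨ʳ {false} h = h

-- Cyclic order and a decision procedure for its universal statements.

cyc′ : ℕ → ℕ → ℕ → Bool
cyc′ a b c = ((a <ᵇ b) ∧ (b <ᵇ c)) ∨ ((b <ᵇ c) ∧ (c <ᵇ a)) ∨ ((c <ᵇ a) ∧ (a <ᵇ b))

-- The closed arc running from a to b; from a to a it is the single point a.
arc′ : ℕ → ℕ → ℕ → Bool
arc′ a b x = cyc′ a x b ∨ (x ≡ᵇ a) ∨ (x ≡ᵇ b)

-- Opaque copies for use outside the decision procedure, where unfolding makes terms explode.
opaque

  cyc : ℕ → ℕ → ℕ → Bool
  cyc = cyc′

  arcℕ : ℕ → ℕ → ℕ → Bool
  arcℕ = arc′

infixr 5 _⇒_
infixr 6 _∨ᶠ_
infixr 7 _∧ᶠ_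

-- Quantifier-free statements whose atoms depend only on the relative order of the entries; this
-- reduces validity to finitely many assignments.
data Formula (m : ℕ) : Set where
  bt ar          : Fin m → Fin m → Fin m → Formula m
  eq             : Fin m → Fin m → Formula m
  ff             : Formula m
  _⇒_ _∨ᶠ_ _∧ᶠ_ : Formula m → Formula m → Formula m

⟦_⟧ : ∀ {m} → Formula m → Vec ℕ m → Set
⟦ bt i j l ⟧ ρ = cyc (lookup ρ i) (lookup ρ j) (lookup ρ l) ≡ true
⟦ ar i j l ⟧ ρ = arcℕ (lookup ρ i) (lookup ρ j) (lookup ρ l) ≡ true
⟦ eq i j ⟧ ρ   = lookup ρ i ≡ lookup ρ j
⟦ ff ⟧ ρ       = ⊥
⟦ φ ⇒ ψ ⟧ ρ    = ⟦ φ ⟧ ρ → ⟦ ψ ⟧ ρ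
⟦ φ ∨ᶠ ψ ⟧ ρ   = ⟦ φ ⟧ ρ ⊎ ⟦ ψ ⟧ ρ
⟦ φ ∧ᶠ ψ ⟧ ρ   = ⟦ φ ⟧ ρ × ⟦ ψ ⟧ ρ

eval : ∀ {m} → Formula m → Vec ℕ m → Bool
eval (bt i j l) ρ = cyc′ (lookup ρ i) (lookup ρ j) (lookup ρ l)
eval (ar i j l) ρ = arc′ (lookup ρ i) (lookup ρ j) (lookup ρ l)
eval (eq i j) ρ   = lookup ρ i ≡ᵇ lookup ρ j
eval ff ρ         = false
eval (φ ⇒ ψ) ρ    = not (eval φ ρ) ∨ eval ψ ρ
eval (φ ∨ᶠ ψ) ρ   = eval φ ρ ∨ eval ψ ρ
eval (φ ∧ᶠ ψ) ρ   = eval φ ρ ∧ eval ψ ρ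

≡true-reflects : ∀ b → Reflects (b ≡ true) b
≡true-reflects true  = ofʸ refl
≡true-reflects false = ofⁿ λ ()

≡ᵇ-reflects : ∀ a b → Reflects (a ≡ b) (a ≡ᵇ b)
≡ᵇ-reflects zero    zero    = ofʸ refl
≡ᵇ-reflects zero    (suc b) = ofⁿ λ ()
≡ᵇ-reflects (suc a) zero    = ofⁿ λ ()
≡ᵇ-reflects (suc a) (suc b) with a ≡ᵇ b | ≡ᵇ-reflects a b
... | true  | ofʸ p = ofʸ (cong suc p)
... | false | ofⁿ p = ofⁿ λ q → p (suc-injective q)

opaque
  unfolding cyc arcℕ

  eval-reflects : ∀ {m} (φ : Formula m) ρ → Reflects (⟦ φ ⟧ ρ) (eval φ ρ)
  eval-reflects (bt i j l) ρ = ≡true-reflects _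
  eval-reflects (ar i j l) ρ = ≡true-reflects _
  eval-reflects (eq i j) ρ   = ≡ᵇ-reflects _ _
  eval-reflects ff ρ         = ofⁿ λ ()
  eval-reflects (φ ⇒ ψ) ρ    = eval-reflects φ ρ →-reflects eval-reflects ψ ρ
  eval-reflects (φ ∨ᶠ ψ) ρ   = eval-reflects φ ρ ⊎-reflects eval-reflects ψ ρ
  eval-reflects (φ ∧ᶠ ψ) ρ   = eval-reflects φ ρ ×-reflects eval-reflects ψ ρ

-- The truth value depends only on the relative order of the entries, so it
-- survives replacing each entry by the number of smaller entries.
below : ∀ {m} → ℕ → Vec ℕ m → ℕ
below x []      = 0
below x (y ∷ ρ) = (if y <ᵇ x then 1 else 0) + below x ρ

below-mono : ∀ {m x y} (ρ : Vec ℕ m) → x ≤ y → below x ρ ≤ below y ρ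
below-mono [] _ = z≤n
below-mono {x = x} {y} (z ∷ ρ) x≤y with z <ᵇ x in p | z <ᵇ y in q
... | false | false = below-mono ρ x≤y
... | false | true  = m≤n⇒m≤1+n (below-mono ρ x≤y)
... | true  | true  = s≤s (below-mono ρ x≤y)
... | true  | false =
  ⊥-elim (subst T q (<⇒<ᵇ (<-≤-trans (<ᵇ⇒< z x (subst T (sym p) _)) x≤y)))

-- The entry at `i` is below `y` but not below itself, so at least one more entry is counted.
below-strict : ∀ {m y} (ρ : Vec ℕ m) i → lookup ρ i < y → below (lookup ρ i) ρ < below y ρ
below-strict {y = y} (z ∷ ρ) zero z<y with z <ᵇ z in p | z <ᵇ y in q
... | true  | _     = ⊥-elim (<-irrefl refl (<ᵇ⇒< z z (subst T (sym p) _)))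
... | false | true  = s≤s (below-mono ρ (<⇒≤ z<y))
... | false | false = ⊥-elim (subst T q (<⇒<ᵇ z<y))
below-strict {y = y} (z ∷ ρ) (suc i) x<y with z <ᵇ lookup ρ i in p | z <ᵇ y in q
... | false | false = below-strict ρ i x<y
... | false | true  = m≤n⇒m≤1+n (below-strict ρ i x<y)
... | true  | true  = s≤s (below-strict ρ i x<y)
... | true  | false =
  ⊥-elim (subst T q (<⇒<ᵇ (<-trans (<ᵇ⇒< z (lookup ρ i) (subst T (sym p) _)) x<y)))

below-≤ : ∀ {m} x (ρ : Vec ℕ m) → below x ρ ≤ m
below-≤ x [] = z≤n
below-≤ x (z ∷ ρ) with z <ᵇ x
... | false = m≤n⇒m≤1+n (below-≤ x ρ)
... | true  = s≤s (below-≤ x ρ)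

-- An entry is never below itself. Hence ranks take only `m` values, which bounds the search in
-- `valid`.
below-< : ∀ {m} (ρ : Vec ℕ m) i → below (lookup ρ i) ρ < m
below-< (z ∷ ρ) zero with z <ᵇ z in p
... | true  = ⊥-elim (<-irrefl refl (<ᵇ⇒< z z (subst T (sym p) _)))
... | false = s≤s (below-≤ z ρ)
below-< (z ∷ ρ) (suc i) with z <ᵇ lookup ρ i
... | false = m≤n⇒m≤1+n (below-< ρ i)
... | true  = s≤s (below-< ρ i)

ranks : ∀ {m} → Vec ℕ m → Vec ℕ m
ranks ρ = map (λ x → below x ρ) ρ

lookup-ranks : ∀ {m} (ρ : Vec ℕ m) i → lookup (ranks ρ) i ≡ below (lookup ρ i) ρ
lookup-ranks ρ i = lookup-map i _ ρ

<ᵇ-cong : ∀ {a b c d} → (a < b → c < d) → (c < d → a < b) → (a <ᵇ b) ≡ (c <ᵇ d)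
<ᵇ-cong {a} {b} {c} {d} f g with a <ᵇ b in p | c <ᵇ d in q
... | true  | true  = refl
... | false | false = refl
... | true  | false = ⊥-elim (subst T q (<⇒<ᵇ (f (<ᵇ⇒< a b (subst T (sym p) _)))))
... | false | true  = ⊥-elim (subst T p (<⇒<ᵇ (g (<ᵇ⇒< c d (subst T (sym q) _)))))

≡ᵇ-cong : ∀ {a b c d} → (a ≡ b → c ≡ d) → (c ≡ d → a ≡ b) → (a ≡ᵇ b) ≡ (c ≡ᵇ d)
≡ᵇ-cong {a} {b} {c} {d} f g with a ≡ᵇ b | ≡ᵇ-reflects a b | c ≡ᵇ d | ≡ᵇ-reflects c d
... | true  | _     | true  | _     = refl
... | false | _     | false | _     = refl
... | true  | ofʸ p | false | ofⁿ q = ⊥-elim (q (f p))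
... | false | ofⁿ p | true  | ofʸ q = ⊥-elim (p (g q))

module _ {m} (ρ : Vec ℕ m) where

  private
    ρ′ = ranks ρ

  ranks-< : ∀ i j → (lookup ρ′ i <ᵇ lookup ρ′ j) ≡ (lookup ρ i <ᵇ lookup ρ j)
  ranks-< i j rewrite lookup-ranks ρ i | lookup-ranks ρ j =
    <ᵇ-cong (λ lt → ≰⇒> λ le → <-irrefl refl (<-≤-trans lt (below-mono ρ le)))
            (below-strict ρ i)

  ranks-≡ : ∀ i j → (lookup ρ′ i ≡ᵇ lookup ρ′ j) ≡ (lookup ρ i ≡ᵇ lookup ρ j)
  ranks-≡ i j rewrite lookup-ranks ρ i | lookup-ranks ρ j =
    ≡ᵇ-cong (λ e → ≤-antisym (≮⇒≥ λ lt → <-irrefl (sym e) (below-strict ρ j lt))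
                             (≮⇒≥ λ lt → <-irrefl e (below-strict ρ i lt)))
            (cong (λ x → below x ρ))

  ranks-cyc : ∀ i j l → cyc′ (lookup ρ′ i) (lookup ρ′ j) (lookup ρ′ l)
                      ≡ cyc′ (lookup ρ i) (lookup ρ j) (lookup ρ l)
  ranks-cyc i j l rewrite ranks-< i j | ranks-< j l | ranks-< l i = refl

  eval-ranks : ∀ φ → eval φ ρ′ ≡ eval φ ρ
  eval-ranks (bt i j l) = ranks-cyc i j l
  eval-ranks (ar i j l) rewrite ranks-cyc i l j | ranks-≡ l i | ranks-≡ l j = refl
  eval-ranks (eq i j)   = ranks-≡ i j
  eval-ranks ff         = refl
  eval-ranks (φ ⇒ ψ)    = cong₂ (λ a b → not a ∨ b) (eval-ranks φ) (eval-ranks ψ)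
  eval-ranks (φ ∨ᶠ ψ)   = cong₂ _∨_ (eval-ranks φ) (eval-ranks ψ)
  eval-ranks (φ ∧ᶠ ψ)   = cong₂ _∧_ (eval-ranks φ) (eval-ranks ψ)

allBelow : ℕ → (ℕ → Bool) → Bool
allBelow zero    p = true
allBelow (suc N) p = p N ∧ allBelow N p

allVec : ∀ m → ℕ → (Vec ℕ m → Bool) → Bool
allVec zero    N p = p []
allVec (suc m) N p = allBelow N λ x → allVec m N λ ρ → p (x ∷ ρ)

allBelow-sound : ∀ N p → allBelow N p ≡ true → ∀ x → x < N → p x ≡ true
allBelow-sound (suc N) p h x x<N with p N in e
allBelow-sound (suc N) p () x x<N | false
... | true with m≤n⇒m<n∨m≡n (≤-pred x<N)
... | inj₁ lt   = allBelow-sound N p h x lt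
... | inj₂ refl = e

allVec-sound : ∀ m N p → allVec m N p ≡ true →
               ∀ ρ → (∀ i → lookup ρ i < N) → p ρ ≡ true
allVec-sound zero    N p h []      _ = h
allVec-sound (suc m) N p h (x ∷ ρ) b =
  allVec-sound m N _ (allBelow-sound N _ h x (b zero)) ρ (λ i → b (suc i))

valid : ∀ {m} → Formula m → Bool
valid {m} φ = allVec m m (eval φ)

-- Decides universally quantified statements about cyclic order by checking all
-- assignments of m variables to m points.
cyclic : ∀ {m} (φ : Formula m) → valid φ ≡ true → ∀ ρ → ⟦ φ ⟧ ρ
cyclic {m} φ h ρ = invert (subst (Reflects _) e (eval-reflects φ ρ))
  where
  e : eval φ ρ ≡ true
  e = trans (sym (eval-ranks ρ φ))
        (allVec-sound m m (eval φ) h (ranks ρ)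
          λ i → subst (_< m) (sym (lookup-ranks ρ i)) (below-< ρ i))

pattern 𝟎 = zero
pattern 𝟏 = suc zero
pattern 𝟐 = suc (suc zero)
pattern 𝟑 = suc (suc (suc zero))
pattern 𝟒 = suc (suc (suc (suc zero)))
pattern 𝟓 = suc (suc (suc (suc (suc zero))))

-- Finite sums, counting and maximisation.

bit : Bool → ℕ
bit b = if b then 1 else 0

bit-mono : ∀ {a b} → (a ≡ true → b ≡ true) → bit a ≤ bit b
bit-mono {false} f = z≤n
bit-mono {true}  f rewrite f refl = ≤-refl

bit-positive : ∀ {b} → 1 ≤ bit b → b ≡ true
bit-positive {true} _ = refl

bit-≤1 : ∀ b → bit b ≤ 1
bit-≤1 false = z≤n
bit-≤1 true  = ≤-refl

sum-mono : ∀ {n} {f g : Fin n → ℕ} → (∀ i → f i ≤ g i) → sumFin f ≤ sumFin g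
sum-mono {zero}  h = z≤n
sum-mono {suc n} h = +-mono-≤ (h zero) (sum-mono λ i → h (suc i))

sum-mono-< : ∀ {n} {f g : Fin n → ℕ} → (∀ i → f i ≤ g i) → ∀ i → f i < g i →
             sumFin f < sumFin g
sum-mono-< h zero    lt = +-mono-<-≤ lt (sum-mono λ i → h (suc i))
sum-mono-< h (suc i) lt = +-mono-≤-< (h zero) (sum-mono-< (λ i → h (suc i)) i lt)

sum-cong : ∀ {n} {f g : Fin n → ℕ} → (∀ i → f i ≡ g i) → sumFin f ≡ sumFin g
sum-cong {zero}  h = refl
sum-cong {suc n} h = cong₂ _+_ (h zero) (sum-cong λ i → h (suc i))

sum-+ : ∀ {n} (f g : Fin n → ℕ) → sumFin (λ i → f i + g i) ≡ sumFin f + sumFin g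
sum-+ {zero}  f g = refl
sum-+ {suc n} f g rewrite sum-+ (λ i → f (suc i)) (λ i → g (suc i)) =
  interchange +-commutativeSemigroup (f zero) (g zero)
    (sumFin λ i → f (suc i)) (sumFin λ i → g (suc i))

sum-0 : ∀ n → sumFin {n} (λ _ → 0) ≡ 0
sum-0 zero    = refl
sum-0 (suc n) = sum-0 n

sum-swap : ∀ {m n} (f : Fin m → Fin n → ℕ) →
           sumFin (λ i → sumFin (f i)) ≡ sumFin (λ j → sumFin (λ i → f i j))
sum-swap {zero} {n} f = sym (sum-0 n)
sum-swap {suc m} f =
  trans (cong (sumFin (f zero) +_) (sum-swap (λ i → f (suc i))))
        (sym (sum-+ (f zero) _))

term≤sum : ∀ {n} (f : Fin n → ℕ) i → f i ≤ sumFin f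
term≤sum f zero    = m≤m+n _ _
term≤sum f (suc i) = ≤-trans (term≤sum (λ i → f (suc i)) i) (m≤n+m _ _)

sum-positive : ∀ {n} (f : Fin n → ℕ) → 1 ≤ sumFin f → ∃ λ i → 1 ≤ f i
sum-positive {suc n} f h with f zero in e
... | suc _ = zero , subst (1 ≤_) (sym e) (s≤s z≤n)
... | zero with sum-positive (λ i → f (suc i)) h
...   | i , p = suc i , p

count≡sum : ∀ {n} (p : Fin n → Bool) → count p ≡ sumFin (λ i → bit (p i))
count≡sum {zero}  p = refl
count≡sum {suc n} p = cong (bit (p zero) +_) (count≡sum (λ i → p (suc i)))

count-mono : ∀ {n} {p q : Fin n → Bool} → (∀ i → p i ≡ true → q i ≡ true) → count p ≤ count q
count-mono {p = p} {q} h rewrite count≡sum p | count≡sum q = sum-mono λ i → bit-mono (h i)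

count-mono-< : ∀ {n} {p q : Fin n → Bool} → (∀ i → p i ≡ true → q i ≡ true) →
               ∀ i → ¬ p i ≡ true → q i ≡ true → count p < count q
count-mono-< {p = p} {q} h i ¬pi qi rewrite count≡sum p | count≡sum q =
  sum-mono-< (λ i → bit-mono (h i)) i lt
  where
  lt : bit (p i) < bit (q i)
  lt rewrite qi with p i
  ... | true  = ⊥-elim (¬pi refl)
  ... | false = ≤-refl

count-∪ : ∀ {n} {p q r : Fin n → Bool} → (∀ i → p i ≡ true → q i ≡ true ⊎ r i ≡ true) →
          count p ≤ count q + count r
count-∪ {p = p} {q} {r} h
  rewrite count≡sum p | count≡sum q | count≡sum r | sym (sum-+ (λ i → bit (q i)) (λ i → bit (r i))) =
  sum-mono λ i → pointwise i
  where
  pointwise : ∀ i → bit (p i) ≤ bit (q i) + bit (r i)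
  pointwise i with p i in e
  ... | false = z≤n
  ... | true with h i e
  ...   | inj₁ qi rewrite qi = s≤s z≤n
  ...   | inj₂ ri rewrite ri = m≤n+m 1 _

count-∨ : ∀ {n} (q r : Fin n → Bool) → count (λ z → q z ∨ r z) ≤ count q + count r
count-∨ q r = count-∪ {q = q} {r} λ z → ∨-true

count-+≤ : ∀ {n} {p q r : Fin n → Bool} →
           (∀ i → p i ≡ true → r i ≡ true) → (∀ i → q i ≡ true → r i ≡ true) →
           (∀ i → p i ≡ true → q i ≡ true → ⊥) →
           count p + count q ≤ count r
count-+≤ {p = p} {q} {r} f g d
  rewrite count≡sum p | count≡sum q | count≡sum r | sym (sum-+ (λ i → bit (p i)) (λ i → bit (q i))) =
  sum-mono λ i → pointwise i
  where
  pointwise : ∀ i → bit (p i) + bit (q i) ≤ bit (r i)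
  pointwise i with p i in e | q i in e'
  ... | false | false = z≤n
  ... | true | true = ⊥-elim (d i e e')
  ... | true | false rewrite f i e = ≤-refl
  ... | false | true rewrite g i e' = ≤-refl

count-false : ∀ n → count {n} (λ _ → false) ≡ 0
count-false zero    = refl
count-false (suc n) = count-false n

count-≤n : ∀ {n} (p : Fin n → Bool) → count p ≤ n
count-≤n {zero}  p = z≤n
count-≤n {suc n} p = +-mono-≤ (bit-≤1 (p zero)) (count-≤n (λ i → p (suc i)))

count-unique : ∀ {n} {p : Fin n → Bool} x → (∀ i → p i ≡ true → i ≡ x) → count p ≤ 1
count-unique {suc n} {p} zero h =
  +-mono-≤ (bit-≤1 (p zero))
           (≤-trans (count-mono {q = λ _ → false} none) (≤-reflexive (count-false n)))
  where
  none : ∀ i → p (suc i) ≡ true → false ≡ true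
  none i e with h (suc i) e
  ... | ()
count-unique {suc n} {p} (suc x) h with p zero in e
... | true with h zero e
...   | ()
count-unique {suc n} {p} (suc x) h | false = count-unique x λ i e → Fin.suc-injective (h (suc i) e)

sum₂ : ∀ {n} → (Fin n → Fin n → ℕ) → ℕ
sum₂ f = sumFin λ x → sumFin λ y → f x y

module _ {n} {f g : Fin n → Fin n → ℕ} where

  sum₂-mono : (∀ x y → f x y ≤ g x y) → sum₂ f ≤ sum₂ g
  sum₂-mono h = sum-mono λ x → sum-mono (h x)

  sum₂-mono-< : (∀ x y → f x y ≤ g x y) → ∀ x y → f x y < g x y → sum₂ f < sum₂ g
  sum₂-mono-< h x y lt = sum-mono-< (λ x → sum-mono (h x)) x (sum-mono-< (h x) y lt)

  sum₂-cong : (∀ x y → f x y ≡ g x y) → sum₂ f ≡ sum₂ g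
  sum₂-cong h = sum-cong λ x → sum-cong (h x)

module _ {n} (f g : Fin n → Fin n → ℕ) where

  sum₂-+ : sum₂ (λ x y → f x y + g x y) ≡ sum₂ f + sum₂ g
  sum₂-+ = trans (sum-cong λ x → sum-+ (f x) (g x))
                 (sum-+ (λ x → sumFin (f x)) (λ x → sumFin (g x)))

sum₂-positive : ∀ {n} (f : Fin n → Fin n → ℕ) → 1 ≤ sum₂ f → ∃₂ λ x y → 1 ≤ f x y
sum₂-positive f h with sum-positive _ h
... | x , p with sum-positive _ p
...   | y , q = x , y , q

term≤sum₂ : ∀ {n} (f : Fin n → Fin n → ℕ) x y → f x y ≤ sum₂ f
term≤sum₂ f x y = ≤-trans (term≤sum (f x) y) (term≤sum (λ x → sumFin (f x)) x)

module _ {n : ℕ} {Q : Fin n → Fin n → Set} (Q? : ∀ a b → Dec (Q a b))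
         (m : Fin n → Fin n → ℕ) (N : ℕ) (m≤N : ∀ a b → m a b ≤ N) where

  Maximiser : Set
  Maximiser = ∃₂ λ a b → Q a b × (∀ c d → Q c d → m c d ≤ m a b)

  -- Moves repeatedly to a strictly better pair. Each move raises `m` by at least one and `m` never
  -- exceeds `N`, so fuel `N` suffices.
  maximise : ∀ {a b} → Q a b → Maximiser
  maximise {a} {b} = go N a b (m≤m+n N _)
    where
    go : ∀ k a b → N ≤ k + m a b → Q a b → Maximiser
    go k a b N≤ q with any? (λ c → any? λ d → Q? c d ×-dec (m a b <? m c d))
    ... | no none = a , b , q , λ c d q′ → ≮⇒≥ λ lt → none (c , d , q′ , lt)
    go zero a b N≤ q | yes (c , d , q′ , lt) =
      ⊥-elim (<-irrefl refl (<-≤-trans lt (≤-trans (m≤N c d) N≤)))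
    go (suc k) a b N≤ q | yes (c , d , q′ , lt) =
      go k c d (≤-trans N≤ (≤-trans (≤-reflexive (sym (+-suc k (m a b)))) (+-monoʳ-≤ k lt))) q′

-- Facts about points, arcs and chords of the circle.

Between In : ℕ → ℕ → ℕ → Set
Between a x b = cyc a x b ≡ true
In a b x      = arcℕ a b x ≡ true

module _ (a b : ℕ) where

  In-start : In a b a
  In-start = cyclic (ar 𝟎 𝟏 𝟎) refl (a ∷ b ∷ [])

  In-end : In a b b
  In-end = cyclic (ar 𝟎 𝟏 𝟏) refl (a ∷ b ∷ [])

  In-singleton : In a a b → b ≡ a
  In-singleton = cyclic (ar 𝟎 𝟎 𝟏 ⇒ eq 𝟏 𝟎) refl (a ∷ b ∷ [])

  Between-irrefl : ¬ Between a b a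
  Between-irrefl = cyclic (bt 𝟎 𝟏 𝟎 ⇒ ff) refl (a ∷ b ∷ [])

module _ (a b x : ℕ) where

  Between⇒In : Between a x b → In a b x
  Between⇒In = cyclic (bt 𝟎 𝟐 𝟏 ⇒ ar 𝟎 𝟏 𝟐) refl (a ∷ b ∷ x ∷ [])

  In-two : ¬ a ≡ b → In a b x ⊎ In b a x
  In-two = cyclic ((eq 𝟎 𝟏 ⇒ ff) ⇒ ar 𝟎 𝟏 𝟐 ∨ᶠ ar 𝟏 𝟎 𝟐) refl (a ∷ b ∷ x ∷ [])

  ¬In⇒Between : ¬ In a b x → a ≡ b ⊎ Between b x a
  ¬In⇒Between = cyclic ((ar 𝟎 𝟏 𝟐 ⇒ ff) ⇒ eq 𝟎 𝟏 ∨ᶠ bt 𝟏 𝟐 𝟎) refl (a ∷ b ∷ x ∷ [])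

  Between⇒¬In : Between b x a → ¬ In a b x
  Between⇒¬In = cyclic (bt 𝟏 𝟐 𝟎 ⇒ ar 𝟎 𝟏 𝟐 ⇒ ff) refl (a ∷ b ∷ x ∷ [])

module _ (a b c z : ℕ) where

  In-three : ¬ a ≡ c → In a b z ⊎ In b c z ⊎ In c a z
  In-three = cyclic ((eq 𝟎 𝟐 ⇒ ff) ⇒ ar 𝟎 𝟏 𝟑 ∨ᶠ ar 𝟏 𝟐 𝟑 ∨ᶠ ar 𝟐 𝟎 𝟑) refl (a ∷ b ∷ c ∷ z ∷ [])

  In-prefix : In a c b → In a b z → In a c z
  In-prefix = cyclic (ar 𝟎 𝟐 𝟏 ⇒ ar 𝟎 𝟏 𝟑 ⇒ ar 𝟎 𝟐 𝟑) refl (a ∷ b ∷ c ∷ z ∷ [])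

  In-suffix : In a c b → In b c z → In a c z
  In-suffix = cyclic (ar 𝟎 𝟐 𝟏 ⇒ ar 𝟏 𝟐 𝟑 ⇒ ar 𝟎 𝟐 𝟑) refl (a ∷ b ∷ c ∷ z ∷ [])

  In-overrun : ¬ In a c b → In a b z ⊎ In b c z
  In-overrun = cyclic ((ar 𝟎 𝟐 𝟏 ⇒ ff) ⇒ ar 𝟎 𝟏 𝟑 ∨ᶠ ar 𝟏 𝟐 𝟑) refl (a ∷ b ∷ c ∷ z ∷ [])

  In-extend-end : ¬ In a b c → In a b z → In a c z
  In-extend-end = cyclic ((ar 𝟎 𝟏 𝟐 ⇒ ff) ⇒ ar 𝟎 𝟏 𝟑 ⇒ ar 𝟎 𝟐 𝟑) refl (a ∷ b ∷ c ∷ z ∷ [])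

  In-extend-start : ¬ In a b c → In a b z → In c b z
  In-extend-start = cyclic ((ar 𝟎 𝟏 𝟐 ⇒ ff) ⇒ ar 𝟎 𝟏 𝟑 ⇒ ar 𝟐 𝟏 𝟑) refl (a ∷ b ∷ c ∷ z ∷ [])

module _ (r q a b y z : ℕ) where

  In-through : In r q a → In r q b → ¬ In r q y → Between a y b → In r q z ⊎ In a b z
  In-through = cyclic
    (ar 𝟎 𝟏 𝟐 ⇒ ar 𝟎 𝟏 𝟑 ⇒ (ar 𝟎 𝟏 𝟒 ⇒ ff) ⇒ bt 𝟐 𝟒 𝟑 ⇒ ar 𝟎 𝟏 𝟓 ∨ᶠ ar 𝟐 𝟑 𝟓) refl
    (r ∷ q ∷ a ∷ b ∷ y ∷ z ∷ [])

  In-exit : In r q a → ¬ In r q b → ¬ In r q y → Between a y b → In r y z → In r b z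
  In-exit = cyclic
    (ar 𝟎 𝟏 𝟐 ⇒ (ar 𝟎 𝟏 𝟑 ⇒ ff) ⇒ (ar 𝟎 𝟏 𝟒 ⇒ ff) ⇒ bt 𝟐 𝟒 𝟑 ⇒ ar 𝟎 𝟒 𝟓 ⇒ ar 𝟎 𝟑 𝟓) refl
    (r ∷ q ∷ a ∷ b ∷ y ∷ z ∷ [])

  In-entry : ¬ In r q a → In r q b → ¬ In r q y → Between a y b → In y r z → In a r z
  In-entry = cyclic
    ((ar 𝟎 𝟏 𝟐 ⇒ ff) ⇒ ar 𝟎 𝟏 𝟑 ⇒ (ar 𝟎 𝟏 𝟒 ⇒ ff) ⇒ bt 𝟐 𝟒 𝟑 ⇒ ar 𝟒 𝟎 𝟓 ⇒ ar 𝟐 𝟎 𝟓) refl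
    (r ∷ q ∷ a ∷ b ∷ y ∷ z ∷ [])

  In-return : In r q b → ¬ In r q y → Between a y b → In y r z → In r q z ⊎ In a b z
  In-return = cyclic
    (ar 𝟎 𝟏 𝟑 ⇒ (ar 𝟎 𝟏 𝟒 ⇒ ff) ⇒ bt 𝟐 𝟒 𝟑 ⇒ ar 𝟒 𝟎 𝟓 ⇒ ar 𝟎 𝟏 𝟓 ∨ᶠ ar 𝟐 𝟑 𝟓) refl
    (r ∷ q ∷ a ∷ b ∷ y ∷ z ∷ [])

module _ (r q a b y : ℕ) where

  In-exit-new : In r q a → ¬ In r q b → ¬ In r q y → Between a y b → ¬ In r y b
  In-exit-new = cyclic
    (ar 𝟎 𝟏 𝟐 ⇒ (ar 𝟎 𝟏 𝟑 ⇒ ff) ⇒ (ar 𝟎 𝟏 𝟒 ⇒ ff) ⇒ bt 𝟐 𝟒 𝟑 ⇒ ar 𝟎 𝟒 𝟑 ⇒ ff) refl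
    (r ∷ q ∷ a ∷ b ∷ y ∷ [])

  In-entry-new : ¬ In r q a → In r q b → ¬ In r q y → Between a y b → ¬ In y r a
  In-entry-new = cyclic
    ((ar 𝟎 𝟏 𝟐 ⇒ ff) ⇒ ar 𝟎 𝟏 𝟑 ⇒ (ar 𝟎 𝟏 𝟒 ⇒ ff) ⇒ bt 𝟐 𝟒 𝟑 ⇒ ar 𝟒 𝟎 𝟐 ⇒ ff) refl
    (r ∷ q ∷ a ∷ b ∷ y ∷ [])

  In-chain : In r q a → ¬ In r q b → In r b y → In r q y ⊎ In a b y
  In-chain = cyclic
    (ar 𝟎 𝟏 𝟐 ⇒ (ar 𝟎 𝟏 𝟑 ⇒ ff) ⇒ ar 𝟎 𝟑 𝟒 ⇒ ar 𝟎 𝟏 𝟒 ∨ᶠ ar 𝟐 𝟑 𝟒) refl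
    (r ∷ q ∷ a ∷ b ∷ y ∷ [])

module _ (p q x y : ℕ) where

  across-covers : Between p x q → Between q y p → Between x q y
  across-covers = cyclic (bt 𝟎 𝟐 𝟏 ⇒ bt 𝟏 𝟑 𝟎 ⇒ bt 𝟐 𝟏 𝟑) refl (p ∷ q ∷ x ∷ y ∷ [])

module _ (a b x y : ℕ) where

  overlap-start : Between a x b → ¬ x ≡ y →
                  In x b y ⊎ (Between x b y × Between y a x) ⊎ In a x y
  overlap-start = cyclic
    (bt 𝟎 𝟐 𝟏 ⇒ (eq 𝟐 𝟑 ⇒ ff) ⇒ ar 𝟐 𝟏 𝟑 ∨ᶠ bt 𝟐 𝟏 𝟑 ∧ᶠ bt 𝟑 𝟎 𝟐 ∨ᶠ ar 𝟎 𝟐 𝟑) refl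
    (a ∷ b ∷ x ∷ y ∷ [])

  overlap-end : Between a y b → ¬ x ≡ y →
                In a y x ⊎ (Between x a y × Between y b x) ⊎ In y b x
  overlap-end = cyclic
    (bt 𝟎 𝟑 𝟏 ⇒ (eq 𝟐 𝟑 ⇒ ff) ⇒ ar 𝟎 𝟑 𝟐 ∨ᶠ bt 𝟐 𝟎 𝟑 ∧ᶠ bt 𝟑 𝟏 𝟐 ∨ᶠ ar 𝟑 𝟏 𝟐) refl
    (a ∷ b ∷ x ∷ y ∷ [])

  nested-start-new : Between a x b → In x b y → ¬ In x y a
  nested-start-new = cyclic (bt 𝟎 𝟐 𝟏 ⇒ ar 𝟐 𝟏 𝟑 ⇒ ar 𝟐 𝟑 𝟎 ⇒ ff) refl (a ∷ b ∷ x ∷ y ∷ [])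

  nested-end-new : Between a y b → In a y x → ¬ In x y b
  nested-end-new = cyclic (bt 𝟎 𝟑 𝟏 ⇒ ar 𝟎 𝟑 𝟐 ⇒ ar 𝟐 𝟑 𝟏 ⇒ ff) refl (a ∷ b ∷ x ∷ y ∷ [])

module _ (a b x y z : ℕ) where

  nested-start : Between a x b → In x b y → In x y z → In a b z
  nested-start = cyclic (bt 𝟎 𝟐 𝟏 ⇒ ar 𝟐 𝟏 𝟑 ⇒ ar 𝟐 𝟑 𝟒 ⇒ ar 𝟎 𝟏 𝟒) refl
    (a ∷ b ∷ x ∷ y ∷ z ∷ [])

  nested-end : Between a y b → In a y x → In x y z → In a b z
  nested-end = cyclic (bt 𝟎 𝟑 𝟏 ⇒ ar 𝟎 𝟑 𝟐 ⇒ ar 𝟐 𝟑 𝟒 ⇒ ar 𝟎 𝟏 𝟒) refl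
    (a ∷ b ∷ x ∷ y ∷ z ∷ [])

  nested-start-between : Between a x b → In x b y → Between x z y → Between a z b
  nested-start-between = cyclic (bt 𝟎 𝟐 𝟏 ⇒ ar 𝟐 𝟏 𝟑 ⇒ bt 𝟐 𝟒 𝟑 ⇒ bt 𝟎 𝟒 𝟏) refl
    (a ∷ b ∷ x ∷ y ∷ z ∷ [])

  nested-end-between : Between a y b → In a y x → Between x z y → Between a z b
  nested-end-between = cyclic (bt 𝟎 𝟑 𝟏 ⇒ ar 𝟎 𝟑 𝟐 ⇒ bt 𝟐 𝟒 𝟑 ⇒ bt 𝟎 𝟒 𝟏) refl
    (a ∷ b ∷ x ∷ y ∷ z ∷ [])

  wrap-start : Between a x b → ¬ x ≡ y → In a x y → In a b z ⊎ In x y z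
  wrap-start = cyclic (bt 𝟎 𝟐 𝟏 ⇒ (eq 𝟐 𝟑 ⇒ ff) ⇒ ar 𝟎 𝟐 𝟑 ⇒ ar 𝟎 𝟏 𝟒 ∨ᶠ ar 𝟐 𝟑 𝟒) refl
    (a ∷ b ∷ x ∷ y ∷ z ∷ [])

  wrap-end : Between a y b → ¬ x ≡ y → In y b x → In a b z ⊎ In x y z
  wrap-end = cyclic (bt 𝟎 𝟑 𝟏 ⇒ (eq 𝟐 𝟑 ⇒ ff) ⇒ ar 𝟑 𝟏 𝟐 ⇒ ar 𝟎 𝟏 𝟒 ∨ᶠ ar 𝟐 𝟑 𝟒) refl
    (a ∷ b ∷ x ∷ y ∷ z ∷ [])

module _ (a b x : ℕ) where

  Between-asym : Between a x b → ¬ Between b x a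
  Between-asym = cyclic (bt 𝟎 𝟐 𝟏 ⇒ bt 𝟏 𝟐 𝟎 ⇒ ff) refl (a ∷ b ∷ x ∷ [])

module _ (a b x y : ℕ) where

  In-comparable : In a b x → In a b y → In a y x ⊎ In a x y
  In-comparable = cyclic (ar 𝟎 𝟏 𝟐 ⇒ ar 𝟎 𝟏 𝟑 ⇒ ar 𝟎 𝟑 𝟐 ∨ᶠ ar 𝟎 𝟐 𝟑) refl (a ∷ b ∷ x ∷ y ∷ [])

  NonCrossing : Set
  NonCrossing = (Between a x b → ¬ Between b y a) × (Between a y b → ¬ Between b x a)

  same-side : ¬ x ≡ y → NonCrossing → (In x y a × In x y b) ⊎ (In y x a × In y x b)
  same-side = cyclic
    ((eq 𝟐 𝟑 ⇒ ff) ⇒ (bt 𝟎 𝟐 𝟏 ⇒ bt 𝟏 𝟑 𝟎 ⇒ ff) ∧ᶠ (bt 𝟎 𝟑 𝟏 ⇒ bt 𝟏 𝟐 𝟎 ⇒ ff) ⇒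
     ar 𝟐 𝟑 𝟎 ∧ᶠ ar 𝟐 𝟑 𝟏 ∨ᶠ ar 𝟑 𝟐 𝟎 ∧ᶠ ar 𝟑 𝟐 𝟏) refl (a ∷ b ∷ x ∷ y ∷ [])

  noncrossing : In x y a → In x y b → NonCrossing
  noncrossing = cyclic
    (ar 𝟐 𝟑 𝟎 ⇒ ar 𝟐 𝟑 𝟏 ⇒ (bt 𝟎 𝟐 𝟏 ⇒ bt 𝟏 𝟑 𝟎 ⇒ ff) ∧ᶠ (bt 𝟎 𝟑 𝟏 ⇒ bt 𝟏 𝟐 𝟎 ⇒ ff)) refl
    (a ∷ b ∷ x ∷ y ∷ [])

module _ (s t u v a b : ℕ) where

  -- If s and t lay beyond the chord ab, the arc [a, b] would be on one side of st and could not
  -- contain both u and v, which st separates.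
  crossing-same-side : Between s u t → Between t v s → NonCrossing s t a b →
                       In a b u → In a b v → In a b s × In a b t
  crossing-same-side = cyclic
    (bt 𝟎 𝟐 𝟏 ⇒ bt 𝟏 𝟑 𝟎 ⇒ (bt 𝟎 𝟒 𝟏 ⇒ bt 𝟏 𝟓 𝟎 ⇒ ff) ∧ᶠ (bt 𝟎 𝟓 𝟏 ⇒ bt 𝟏 𝟒 𝟎 ⇒ ff) ⇒
     ar 𝟒 𝟓 𝟐 ⇒ ar 𝟒 𝟓 𝟑 ⇒ ar 𝟒 𝟓 𝟎 ∧ᶠ ar 𝟒 𝟓 𝟏) refl
    (s ∷ t ∷ u ∷ v ∷ a ∷ b ∷ [])

module _ (x y s t t′ z : ℕ) where

  In-detour : Between x t y → Between y t′ x → Between s y t′ →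
              In t′ t z ⊎ In x y z ⊎ In s t′ z
  In-detour = cyclic
    (bt 𝟎 𝟑 𝟏 ⇒ bt 𝟏 𝟒 𝟎 ⇒ bt 𝟐 𝟏 𝟒 ⇒ ar 𝟒 𝟑 𝟓 ∨ᶠ ar 𝟎 𝟏 𝟓 ∨ᶠ ar 𝟐 𝟒 𝟓) refl
    (x ∷ y ∷ s ∷ t ∷ t′ ∷ z ∷ [])

  between-hull : Between x t y → Between y s x → Between y t′ x → In s t′ t →
                 Between x z y → Between s z t′
  between-hull = cyclic
    (bt 𝟎 𝟑 𝟏 ⇒ bt 𝟏 𝟐 𝟎 ⇒ bt 𝟏 𝟒 𝟎 ⇒ ar 𝟐 𝟒 𝟑 ⇒ bt 𝟎 𝟓 𝟏 ⇒ bt 𝟐 𝟓 𝟒) refl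
    (x ∷ y ∷ s ∷ t ∷ t′ ∷ z ∷ [])

module _ (a b x : ℕ) where

  distinct-between : ¬ a ≡ b → ¬ x ≡ a → ¬ x ≡ b → ¬ Between b x a → Between a x b
  distinct-between = cyclic
    ((eq 𝟎 𝟏 ⇒ ff) ⇒ (eq 𝟐 𝟎 ⇒ ff) ⇒ (eq 𝟐 𝟏 ⇒ ff) ⇒ (bt 𝟏 𝟐 𝟎 ⇒ ff) ⇒ bt 𝟎 𝟐 𝟏) refl
    (a ∷ b ∷ x ∷ [])

-- Small arcs and the covering argument.

module Circle {n : ℕ} (pos : Fin n → ℕ) (pos-injective : ∀ {u v} → pos u ≡ pos v → u ≡ v)
              (w : Fin n → Bool) where

  between arc : Fin n → Fin n → Fin n → Bool
  between a x b = cyc (pos a) (pos x) (pos b)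
  arc a b x     = arcℕ (pos a) (pos b) (pos x)

  Btw On : Fin n → Fin n → Fin n → Set
  Btw a x b = Between (pos a) (pos x) (pos b)
  On a b x  = In (pos a) (pos b) (pos x)

  Btw? : ∀ a x b → Dec (Btw a x b)
  Btw? a x b = between a x b Bool.≟ true

  On? : ∀ a b x → Dec (On a b x)
  On? a b x = arc a b x Bool.≟ true

  W : ℕ
  W = count w

  -- Only the points marked by `w`, later the vertices of the subgraph, carry weight; the other
  -- points still serve as ends of arcs.
  Small : Fin n → Fin n → Set
  Small a b = 3 * count (λ z → w z ∧ arc a b z) < W

  opaque

    Small? : ∀ a b → Dec (Small a b)
    Small? a b = _ <? _

  -- Counts all points, marked or not, so that a proper inclusion of arcs always increases it
  -- strictly.
  length : Fin n → Fin n → ℕ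
  length a b = count (arc a b)

  length≤n : ∀ a b → length a b ≤ n
  length≤n a b = count-≤n (arc a b)

  -- Each arc carries less than a third of the weight, so the three together carry less than all of
  -- it.
  no-cover : ∀ {a b c d e f} → Small a b → Small c d → Small e f →
             (∀ z → On a b z ⊎ On c d z ⊎ On e f z) → ⊥
  no-cover {a} {b} {c} {d} {e} {f} ab cd ef cover =
    <-irrefl refl (begin-strict
      3 * W                              ≤⟨ *-monoʳ-≤ 3 W≤ ⟩
      3 * (m₁ + (m₂ + m₃))               ≡⟨ *-distribˡ-+ 3 m₁ (m₂ + m₃) ⟩
      3 * m₁ + 3 * (m₂ + m₃)             ≡⟨ cong (3 * m₁ +_) (*-distribˡ-+ 3 m₂ m₃) ⟩
      3 * m₁ + (3 * m₂ + 3 * m₃)         <⟨ +-mono-< ab (+-mono-< cd ef) ⟩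
      W + (W + W)                        ≡⟨ cong (λ x → W + (W + x)) (sym (+-identityʳ W)) ⟩
      3 * W                              ∎)
    where
    open ≤-Reasoning
    on : Fin n → Fin n → Fin n → Bool
    on a b z = w z ∧ arc a b z
    m₁ = count (on a b)
    m₂ = count (on c d)
    m₃ = count (on e f)
    W≤ : W ≤ m₁ + (m₂ + m₃)
    W≤ = ≤-trans (count-∪ {r = λ z → on c d z ∨ on e f z} split)
           (+-monoʳ-≤ m₁ (count-∪ {r = on e f} λ z → ∨-true))
      where
      split : ∀ z → w z ≡ true → on a b z ≡ true ⊎ on c d z ∨ on e f z ≡ true
      split z wz with cover z
      ... | inj₁ h        rewrite wz = inj₁ h
      ... | inj₂ (inj₁ h) rewrite wz | h = inj₂ refl
      ... | inj₂ (inj₂ h) rewrite wz | h with arc c d z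
      ...   | true  = inj₂ refl
      ...   | false = inj₂ refl

  no-cover₂ : ∀ {a b c d} → Small a b → Small c d → (∀ z → On a b z ⊎ On c d z) → ⊥
  no-cover₂ ab cd cover = no-cover ab cd cd λ z → Sum.map₂ inj₁ (cover z)

  _⊆ₐ_ : Fin n × Fin n → Fin n × Fin n → Set
  (a , b) ⊆ₐ (c , d) = ∀ z → On a b z → On c d z

  Small-⊆ : ∀ {a b c d} → (a , b) ⊆ₐ (c , d) → Small c d → Small a b
  Small-⊆ sub small = ≤-<-trans
    (*-monoʳ-≤ 3 (count-mono λ z h → true-∧ (proj₁ (∧-true h)) (sub z (proj₂ (∧-true h))))) small

  length-< : ∀ {a b c d} → (a , b) ⊆ₐ (c , d) → ∀ z → ¬ On a b z → On c d z →
             length a b < length c d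
  length-< sub z out into = count-mono-< sub z out into

  -- Subgraphs with at most three vertices, where this fails, are separated directly.
  Small-singleton : 4 ≤ W → ∀ a → Small a a
  Small-singleton 4≤W a = ≤-trans (s≤s (*-monoʳ-≤ 3 (count-unique a λ z h →
    pos-injective (In-singleton (pos a) (pos z) (proj₂ (∧-true {w z} h)))))) 4≤W

  Small-asym : ∀ a b → ¬ a ≡ b → Small a b → Small b a → ⊥
  Small-asym a b a≢b ab ba =
    no-cover₂ ab ba λ z → In-two (pos a) (pos b) (pos z) (a≢b ∘ pos-injective)

  Small-acyclic : ∀ a b c → ¬ a ≡ c → Small a b → Small b c → Small c a → ⊥
  Small-acyclic a b c a≢c ab bc ca =
    no-cover ab bc ca λ z → In-three (pos a) (pos b) (pos c) (pos z) (a≢c ∘ pos-injective)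

  -- If `b` were off the arc from `a` to `c`, the first two arcs alone would go all the way round
  -- the circle.
  Small-join : ∀ a b c → Small a b → Small b c → Small a c →
               ((a , b) ⊆ₐ (a , c)) × ((b , c) ⊆ₐ (a , c))
  Small-join a b c ab bc ac with On? a c b
  ... | yes b∈ = (λ z → In-prefix (pos a) (pos b) (pos c) (pos z) b∈)
               , (λ z → In-suffix (pos a) (pos b) (pos c) (pos z) b∈)
  ... | no b∉  = ⊥-elim (no-cover₂ ab bc λ z → In-overrun (pos a) (pos b) (pos c) (pos z) b∉)

  -- For comparable ends, the only alternative is a directed triangle of small arcs, which covers
  -- the circle.
  Small-trans : ∀ a b c → Small a b → Small b c → Small a c ⊎ Small c a → Small a c
  Small-trans a b c ab bc (inj₁ ac) = ac
  Small-trans a b c ab bc (inj₂ ca) with a Fin.≟ c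
  ... | yes refl = ca
  ... | no a≢c   = ⊥-elim (Small-acyclic a b c a≢c ab bc ca)

  -- The hull starts at `s`, the earlier of the two starts, and finishes at whichever of `t` and
  -- `t′` comes later.
  Small-hull : ∀ s t s′ t′ → Small s t → Small s′ t′ → Small s s′ →
               Small t t′ ⊎ Small t′ t → Small s t′ ⊎ Small t′ s →
               ∃₂ λ c d → Small c d × ((s , t) ⊆ₐ (c , d)) × ((s′ , t′) ⊆ₐ (c , d))
  Small-hull s t s′ t′ st s′t′ ss′ (inj₁ tt′) h = s , t′ , st′ ,
    proj₁ (Small-join s t t′ st tt′ st′) , proj₂ (Small-join s s′ t′ ss′ s′t′ st′)
    where
    st′ = Small-trans s t t′ st tt′ h
  Small-hull s t s′ t′ st s′t′ ss′ (inj₂ t′t) h = s , t , st , (λ z → id) ,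
    λ z → proj₁ (Small-join s t′ t st′ t′t st) z ∘ proj₂ (Small-join s s′ t′ ss′ s′t′ st′) z
    where
    st′ = Small-trans s s′ t′ ss′ s′t′ h

  module Covering {P : Fin n → Set}
    (total : ∀ p q → P p → P q → Small p q ⊎ Small q p)
    (covered : ∀ r → ¬ P r → ∃₂ λ a b → Small a b × Btw a r b × (P a ⊎ P b))
    (r q : Fin n) (Pr : P r) (Pq : P q) (Small-rq : Small r q)
    (longest : ∀ {c d} → P c → P d → Small c d → length c d ≤ length r q) where

    -- A point `s` of `P` off the arc either extends it at one end, against the choice of the
    -- longest arc, or closes a directed triangle with `r` and `q`.
    P⊆rq : ∀ s → P s → On r q s
    P⊆rq s ps = decidable-stable (On? r q s) λ s∉ → absurd s∉ (total r s Pr ps) (total q s Pq ps)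
      where
      absurd : ¬ On r q s → Small r s ⊎ Small s r → Small q s ⊎ Small s q → ⊥
      absurd s∉ (inj₁ rs) _ = <⇒≱
        (length-< (λ z → In-extend-end (pos r) (pos q) (pos s) (pos z) s∉)
                  s s∉ (In-end (pos r) (pos s)))
        (longest Pr ps rs)
      absurd s∉ (inj₂ sr) (inj₁ qs) =
        Small-acyclic r q s (λ { refl → s∉ (In-start (pos r) (pos q)) }) Small-rq qs sr
      absurd s∉ (inj₂ _) (inj₂ sq) = <⇒≱
        (length-< (λ z → In-extend-start (pos r) (pos q) (pos s) (pos z) s∉)
                  s s∉ (In-start (pos s) (pos q)))
        (longest ps Pq sq)

    -- An arc with both ends in [r, q] that passes over a point outside contains the whole
    -- complement of [r, q].
    through : ∀ a b y → Small a b → On r q a → On r q b → ¬ On r q y → Btw a y b → ⊥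
    through a b y ab a∈ b∈ y∉ h = no-cover₂ Small-rq ab λ z →
      In-through (pos r) (pos q) (pos a) (pos b) (pos y) (pos z) a∈ b∈ y∉ h

    outer : ∀ y → ¬ On r q y → ∃₂ λ a b → Small a b × Btw a y b × (On r q a ⊎ On r q b)
    outer y y∉ with covered y (y∉ ∘ P⊆rq y)
    ... | a , b , ab , h , e = a , b , ab , h , Sum.map (P⊆rq a) (P⊆rq b) e

    Exit : Fin n → Fin n → Set
    Exit a b = Small a b × On r q a × ¬ On r q b

    Exit? : ∀ a b → Dec (Exit a b)
    Exit? a b = Small? a b ×-dec On? r q a ×-dec ¬? (On? r q b)

    -- Take the exit reaching farthest from `r` and an arc covering its end `b`. If that arc starts
    -- in [r, q], it runs through or is an exit reaching farther.
    no-exit : ∀ a b → ¬ Exit a b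
    no-exit a b exit with maximise Exit? (λ _ b → length r b) n (λ _ → length≤n r) exit
    ... | a , b , (ab , a∈ , b∉) , max with outer b b∉
    ... | a′ , b′ , ab′ , h , inj₁ a′∈ with On? r q b′
    ...   | yes b′∈ = through a′ b′ b ab′ a′∈ b′∈ b∉ h
    ...   | no b′∉  = <⇒≱
      (length-< (λ z → In-exit (pos r) (pos q) (pos a′) (pos b′) (pos b) (pos z) a′∈ b′∉ b∉ h)
                b′ (In-exit-new (pos r) (pos q) (pos a′) (pos b′) (pos b) a′∈ b′∉ b∉ h)
                (In-end (pos r) (pos b′)))
      (max a′ b′ (ab′ , a′∈ , b′∉))
    -- The covering arc ends in [r, q]. Then [r, q] and [a, b] cover everything from `r` to `b`, and
    -- [a′, b′] with [r, q] covers the way back.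
    no-exit _ _ _ | a , b , (ab , a∈ , b∉) , max | a′ , b′ , ab′ , h , inj₂ b′∈ =
      no-cover Small-rq ab ab′ cover
      where
      r≢b : ¬ pos r ≡ pos b
      r≢b e = b∉ (subst (In (pos r) (pos q)) e (In-start (pos r) (pos q)))
      cover : ∀ z → On r q z ⊎ On a b z ⊎ On a′ b′ z
      cover z with In-two (pos r) (pos b) (pos z) r≢b
      ... | inj₁ z∈ = Sum.map₂ inj₁
        (In-chain (pos r) (pos q) (pos a) (pos b) (pos z) a∈ b∉ z∈)
      ... | inj₂ z∈ = Sum.map₂ inj₂
        (In-return (pos r) (pos q) (pos a′) (pos b′) (pos b) (pos z) b′∈ b∉ h z∈)

    -- The point `y` outside [r, q] with the longest arc back to `r` is the first one after `q`. An
    -- arc covering it cannot start in [r, q], by `through` and `no-exit`; so it starts at a point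
    -- outside that precedes `y`.
    absurdity : ⊥
    absurdity with any? (λ y → ¬? (On? r q y))
    ... | no all∈ = no-cover₂ Small-rq Small-rq λ z →
      inj₁ (decidable-stable (On? r q z) λ z∉ → all∈ (z , z∉))
    ... | yes (y₀ , y₀∉)
      with maximise (λ y _ → ¬? (On? r q y)) (λ y _ → length y r) n (λ y _ → length≤n y r)
                    {y₀} {y₀} y₀∉
    ... | y , _ , y∉ , max with outer y y∉
    ... | a , b , ab , h , inj₁ a∈ with On? r q b
    ...   | yes b∈ = through a b y ab a∈ b∈ y∉ h
    ...   | no b∉  = no-exit a b (ab , a∈ , b∉)
    absurdity | yes _ | y , _ , y∉ , max | a , b , ab , h , inj₂ b∈ with On? r q a
    ... | yes a∈ = through a b y ab a∈ b∈ y∉ h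
    ... | no a∉  = <⇒≱
      (length-< (λ z → In-entry (pos r) (pos q) (pos a) (pos b) (pos y) (pos z) a∉ b∈ y∉ h)
                a (In-entry-new (pos r) (pos q) (pos a) (pos b) (pos y) a∉ b∈ y∉ h)
                (In-start (pos a) (pos r)))
      (max a a a∉)

  -- The longest small arc [r, q] spanned by P contains all of P by acyclicity, and
  -- then two of the arcs covering its complement complete it to a cover of the circle.
  covering-impossible : {P : Fin n → Set} → (∀ p → Dec (P p)) → Fin n →
    (∀ p q → P p → P q → Small p q ⊎ Small q p) →
    (∀ r → ¬ P r → ∃₂ λ a b → Small a b × Btw a r b × (P a ⊎ P b)) → ⊥
  covering-impossible {P} P? z₀ total covered = go nonempty
    where
    nonempty : ∃ P
    nonempty with P? z₀
    ... | yes p = z₀ , p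
    ... | no ¬p with covered z₀ ¬p
    ...   | a , b , _ , _ , inj₁ pa = a , pa
    ...   | a , b , _ , _ , inj₂ pb = b , pb
    go : ∃ P → ⊥
    go (p , pp) with maximise (λ a b → P? a ×-dec P? b ×-dec Small? a b) length n length≤n
                              (pp , pp , [ id , id ]′ (total p p pp pp))
    ... | r , q , (Pr , Pq , rq) , max =
      Covering.absurdity total covered r q Pr Pq rq λ pc pd s → max _ _ (pc , pd , s)

-- Crossings of a chord and arcs covering its ends.

does-sound : ∀ {P : Set} (d : Dec P) → does d ≡ true → P
does-sound (yes p) _ = p

exactly-one : ∀ {P Q : Set} (d : Dec P) (e : Dec Q) → P ⊎ Q → (P → Q → ⊥) →
              1 ≡ bit (does d) + bit (does e) + 0
exactly-one (yes p) (yes q) _ h = ⊥-elim (h p q)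
exactly-one (yes _) (no _)  _ _ = refl
exactly-one (no _)  (yes _) _ _ = refl
exactly-one (no ¬p) (no ¬q) h _ = ⊥-elim ([ ¬p , ¬q ]′ h)

module EdgeCount {n : ℕ} (pos : Fin n → ℕ) (pos-injective : ∀ {u v} → pos u ≡ pos v → u ≡ v)
                 (w : Fin n → Bool) (adj : Fin n → Fin n → Bool)
                 (adj-sym : ∀ u v → adj u v ≡ adj v u) (adj-irrefl : ∀ v → adj v v ≡ false) where

  open Circle pos pos-injective w public

  across : Fin n → Fin n → Fin n → Fin n → Bool
  across p q x y = between p x q ∧ between q y p

  -- Only pairs with x on the arc from p to q, so each edge crossing pq counts once.
  E : Fin n → Fin n → ℕ
  E p q = sum₂ λ x y → bit (adj x y ∧ across p q x y)

  across-swap : ∀ p q x y → across p q x y ≡ across q p y x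
  across-swap p q x y = ∧-comm (between p x q) (between q y p)

  E-sym : ∀ p q → E p q ≡ E q p
  E-sym p q = trans
    (sum₂-cong λ x y → cong₂ (λ a b → bit (a ∧ b)) (adj-sym x y) (across-swap p q x y))
    (sum-swap λ x y → bit (adj y x ∧ across q p y x))

  adj-distinct : ∀ x y → adj x y ≡ true → ¬ x ≡ y
  adj-distinct x .x h refl with trans (sym h) (adj-irrefl x)
  ... | ()

  -- The parameter `light` selects the edges known to have a small arc: all of them for k-planar
  -- drawings; for min-k-planar ones first those with at most k crossings, later all.
  module Arcs (light : Fin n → Fin n → Bool) (light-sym : ∀ x y → light x y ≡ light y x)
              (orient : ∀ x y → adj x y ≡ true → light x y ≡ true → Small x y ⊎ Small y x) where

    -- A: light edges, directed along their small arc.  U: heavy edges, in both directions.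
    A U : Fin n → Fin n → Bool
    A x y = adj x y ∧ (light x y ∧ does (Small? x y))
    U x y = adj x y ∧ not (light x y)

    A? : ∀ x y → Dec (A x y ≡ true)
    A? x y = A x y Bool.≟ true

    A⇒adj : ∀ x y → A x y ≡ true → adj x y ≡ true
    A⇒adj x y h = proj₁ (∧-true h)

    A⇒light : ∀ x y → A x y ≡ true → light x y ≡ true
    A⇒light x y h = proj₁ (∧-true (proj₂ (∧-true {adj x y} h)))

    A⇒Small : ∀ x y → A x y ≡ true → Small x y
    A⇒Small x y h = does-sound (Small? x y) (proj₂ (∧-true {light x y} (proj₂ (∧-true {adj x y} h))))

    D : Fin n → ℕ
    D p = sum₂ λ x y → bit (A x y ∧ between x p y)

    U# : Fin n → Fin n → ℕ
    U# p q = sum₂ λ x y → bit (U x y ∧ across p q x y)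

    -- By `Small-asym` a light edge is directed in exactly one of the two ways.
    adj-split : ∀ x y → bit (adj x y) ≡ bit (A x y) + bit (A y x) + bit (U x y)
    adj-split x y rewrite adj-sym y x | light-sym y x with adj x y in e | light x y in l
    ... | false | _     = refl
    ... | true  | false = refl
    ... | true  | true  = exactly-one (Small? x y) (Small? y x) (orient x y e l)
                            (Small-asym x y (adj-distinct x y e))

    A# : Fin n → Fin n → ℕ
    A# p q = sum₂ λ x y → bit (A x y ∧ across p q x y) + bit (A x y ∧ across p q y x)

    -- `E` fixes which end of an edge lies on which side of pq, whereas `A` fixes a direction; hence
    -- light edges contribute two terms, one per direction of crossing.
    E-split : ∀ p q → E p q ≡ A# p q + U# p q
    E-split p q = begin
      E p q
        ≡⟨ sum₂-cong (λ x y → restrict x y (across p q x y)) ⟩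
      sum₂ (λ x y → a₁ x y + a₂ x y + u x y)
        ≡⟨ sum₂-+ (λ x y → a₁ x y + a₂ x y) u ⟩
      sum₂ (λ x y → a₁ x y + a₂ x y) + U# p q
        ≡⟨ cong (_+ U# p q) (sum₂-+ a₁ a₂) ⟩
      sum₂ a₁ + sum₂ a₂ + U# p q
        -- Transposing the second sum indexes every arc by its own start and end.
        ≡⟨ cong (λ s → sum₂ a₁ + s + U# p q) (sum-swap a₂) ⟩
      sum₂ a₁ + sum₂ (λ x y → a₂ y x) + U# p q
        ≡⟨ cong (_+ U# p q) (sum₂-+ a₁ (λ x y → a₂ y x)) ⟨
      A# p q + U# p q ∎
      where
      open ≡-Reasoning
      a₁ a₂ u : Fin n → Fin n → ℕ
      a₁ x y = bit (A x y ∧ across p q x y)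
      a₂ x y = bit (A y x ∧ across p q x y)
      u  x y = bit (U x y ∧ across p q x y)
      restrict : ∀ x y c → bit (adj x y ∧ c) ≡ bit (A x y ∧ c) + bit (A y x ∧ c) + bit (U x y ∧ c)
      restrict x y true rewrite ∧-identityʳ (adj x y) | ∧-identityʳ (A x y)
                             | ∧-identityʳ (A y x) | ∧-identityʳ (U x y) = adj-split x y
      restrict x y false
        rewrite ∧-zeroʳ (adj x y) | ∧-zeroʳ (A x y) | ∧-zeroʳ (A y x) | ∧-zeroʳ (U x y) = refl

    across⇒between : ∀ p q x y → across p q x y ≡ true → Btw x q y
    across⇒between p q x y h with ∧-true {between p x q} h
    ... | h₁ , h₂ = across-covers (pos p) (pos q) (pos x) (pos y) h₁ h₂

    bit-∧-mono : ∀ a {b c} → (a ≡ true → b ≡ true → c ≡ true) → bit (a ∧ b) ≤ bit (a ∧ c)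
    bit-∧-mono false f = z≤n
    bit-∧-mono true  f = bit-mono (f refl)

    -- A directed arc crossing pq leaves one side and ends on the other, so it passes over `q` or
    -- over `p`, depending on its direction, and is charged there.
    E≤D+D : ∀ p q → E p q ≤ D p + D q + U# p q
    E≤D+D p q = begin
      E p q            ≡⟨ E-split p q ⟩
      A# p q + U# p q  ≤⟨ +-monoˡ-≤ (U# p q) (sum₂-mono bound) ⟩
      sum₂ (λ x y → bit (A x y ∧ between x q y) + bit (A x y ∧ between x p y)) + U# p q
        ≡⟨ cong (_+ U# p q) (trans (sum₂-+ (λ x y → bit (A x y ∧ between x q y)) _)
                                   (+-comm (D q) (D p))) ⟩
      D p + D q + U# p q ∎
      where
      open ≤-Reasoning
      bound : ∀ x y → bit (A x y ∧ across p q x y) + bit (A x y ∧ across p q y x)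
                    ≤ bit (A x y ∧ between x q y) + bit (A x y ∧ between x p y)
      bound x y = +-mono-≤
        (bit-∧-mono (A x y) λ _ → across⇒between p q x y)
        (bit-∧-mono (A x y) λ _ h → across⇒between q p x y (trans (sym (across-swap p q y x)) h))

    D-cover : ∀ r → 1 ≤ D r → ∃₂ λ a b → A a b ≡ true × Btw a r b
    D-cover r h with sum₂-positive _ h
    ... | a , b , p with A a b ∧ between a r b in e
    ...   | true = a , b , ∧-true e

    D≥1 : ∀ r a b → A a b ≡ true → Btw a r b → 1 ≤ D r
    D≥1 r a b h₁ h₂ = subst (_≤ D r) (cong bit (true-∧ h₁ h₂))
      (term≤sum₂ (λ x y → bit (A x y ∧ between x r y)) a b)

    -- Any other arc containing [x, y] would pass strictly over `x` or strictly over `y`; the two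
    -- conditions exclude these cases.
    record Maximal (x y : Fin n) : Set where
      field
        isArc    : A x y ≡ true
        no-start : ∀ a b → A a b ≡ true → Btw a x b → ¬ On x b y
        no-end   : ∀ a b → A a b ≡ true → Btw a y b → ¬ On a y x

    -- A longest arc over `r` works, since any arc containing it also covers `r`.
    maximal : ∀ r → 1 ≤ D r → ∃₂ λ x y → Btw x r y × Maximal x y
    maximal r D≥ with D-cover r D≥
    ... | a , b , h with maximise (λ a b → A? a b ×-dec Btw? a r b) length n length≤n h
    ... | x , y , (xy , xry) , max = x , y , xry , record
      { isArc    = xy
      ; no-start = λ a b ab axb y∈ → <⇒≱
          (length-< (λ z → nested-start (pos a) (pos b) (pos x) (pos y) (pos z) axb y∈)
             a (nested-start-new (pos a) (pos b) (pos x) (pos y) axb y∈) (In-start (pos a) (pos b)))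
          (max a b (ab , nested-start-between (pos a) (pos b) (pos x) (pos y) (pos r) axb y∈ xry))
      ; no-end   = λ a b ab ayb x∈ → <⇒≱
          (length-< (λ z → nested-end (pos a) (pos b) (pos x) (pos y) (pos z) ayb x∈)
             b (nested-end-new (pos a) (pos b) (pos x) (pos y) ayb x∈) (In-end (pos a) (pos b)))
          (max a b (ab , nested-end-between (pos a) (pos b) (pos x) (pos y) (pos r) ayb x∈ xry))
      }

    module _ {x y : Fin n} (M : Maximal x y) where
      open Maximal M

      maximal-distinct : ¬ pos x ≡ pos y
      maximal-distinct e = adj-distinct x y (A⇒adj x y isArc) (pos-injective e)

      -- An arc over `x` could otherwise contain [x, y], against maximality, or wrap around to
      -- overlap it at both ends, so that two small arcs cover the circle.
      cross-start : ∀ a b → A a b ≡ true → Btw a x b → Btw x b y × Btw y a x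
      cross-start a b ab axb
        with overlap-start (pos a) (pos b) (pos x) (pos y) axb maximal-distinct
      ... | inj₁ y∈        = ⊥-elim (no-start a b ab axb y∈)
      ... | inj₂ (inj₁ h)  = h
      ... | inj₂ (inj₂ y∈) = ⊥-elim (no-cover₂ (A⇒Small a b ab) (A⇒Small x y isArc) λ z →
        wrap-start (pos a) (pos b) (pos x) (pos y) (pos z) axb maximal-distinct y∈)

      cross-end : ∀ a b → A a b ≡ true → Btw a y b → Btw x a y × Btw y b x
      cross-end a b ab ayb
        with overlap-end (pos a) (pos b) (pos x) (pos y) ayb maximal-distinct
      ... | inj₁ x∈        = ⊥-elim (no-end a b ab ayb x∈)
      ... | inj₂ (inj₁ h)  = h
      ... | inj₂ (inj₂ x∈) = ⊥-elim (no-cover₂ (A⇒Small a b ab) (A⇒Small x y isArc) λ z →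
        wrap-end (pos a) (pos b) (pos x) (pos y) (pos z) ayb maximal-distinct x∈)

      -- The converse of `E≤D+D` at the ends of a maximal arc: all arcs over `x` or `y` cross xy,
      -- and those over `x` do so in the opposite direction to those over `y`, so none is counted
      -- twice.
      D+D≤E : D x + D y + U# x y ≤ E x y
      D+D≤E = begin
        D x + D y + U# x y
          ≡⟨ cong (_+ U# x y) (trans (+-comm (D x) (D y))
                                     (sym (sum₂-+ (λ a b → bit (A a b ∧ between a y b)) _))) ⟩
        sum₂ (λ a b → bit (A a b ∧ between a y b) + bit (A a b ∧ between a x b)) + U# x y
          ≤⟨ +-monoˡ-≤ (U# x y) (sum₂-mono bound) ⟩
        A# x y + U# x y ≡⟨ E-split x y ⟨
        E x y ∎
        where
        open ≤-Reasoning
        bound : ∀ a b → bit (A a b ∧ between a y b) + bit (A a b ∧ between a x b)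
                      ≤ bit (A a b ∧ across x y a b) + bit (A a b ∧ across x y b a)
        bound a b = +-mono-≤
          (bit-∧-mono (A a b) λ ab h → true-∧ (proj₁ (cross-end a b ab h)) (proj₂ (cross-end a b ab h)))
          (bit-∧-mono (A a b) λ ab h → true-∧ (proj₁ (cross-start a b ab h)) (proj₂ (cross-start a b ab h)))

    U#≡0 : (∀ x y → light x y ≡ true) → ∀ p q → U# p q ≡ 0
    U#≡0 all-light p q = trans (sum₂-cong zero-at) (trans (sum-cong {n} (λ _ → sum-0 n)) (sum-0 n))
      where
      zero-at : ∀ x y → bit (U x y ∧ across p q x y) ≡ 0
      zero-at x y rewrite all-light x y with adj x y
      ... | true  = refl
      ... | false = refl

    E≤D+D-light : (∀ x y → light x y ≡ true) → ∀ p q → E p q ≤ D p + D q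
    E≤D+D-light all-light p q = subst (E p q ≤_)
      (trans (cong (D p + D q +_) (U#≡0 all-light p q)) (+-identityʳ _)) (E≤D+D p q)

-- The contradiction for k-planar drawings.

half-≤ : ∀ {x y k} → x + y ≤ k → x + x ≤ k ⊎ y + y ≤ k
half-≤ {x} {y} h with ≤-total x y
... | inj₁ x≤y = inj₁ (≤-trans (+-monoʳ-≤ x x≤y) h)
... | inj₂ y≤x = inj₂ (≤-trans (+-monoˡ-≤ y y≤x) h)

double-≤-cancel : ∀ {x y} → x + x ≤ y + y → x ≤ y
double-≤-cancel {x} {y} h = ≮⇒≥ λ y<x → <⇒≱ (+-mono-< y<x y<x) h

double-<-cancel : ∀ {x y} → x + x < y + y → x < y
double-<-cancel {x} {y} h = ≰⇒> λ y≤x → <⇒≱ h (+-mono-≤ y≤x y≤x)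

module NoSeparator {n : ℕ} (pos : Fin n → ℕ) (pos-injective : ∀ {u v} → pos u ≡ pos v → u ≡ v)
  (w : Fin n → Bool) (adj : Fin n → Fin n → Bool)
  (adj-sym : ∀ u v → adj u v ≡ adj v u) (adj-irrefl : ∀ v → adj v v ≡ false) (z₀ : Fin n) where

  open EdgeCount pos pos-injective w adj adj-sym adj-irrefl public

  -- Membership in P is `D p + D p ≤ k`: two members have depths adding up to at most `k`, and of
  -- two depths adding up to at most `k` the smaller one qualifies.
  kPlanar-impossible : ∀ k → (∀ x y → adj x y ≡ true → E x y ≤ k) →
    (∀ p q → E p q < suc k → Small p q ⊎ Small q p) → ⊥
  kPlanar-impossible k planar total =
    covering-impossible (λ p → D p + D p ≤? k) z₀
      (λ p q Pp Pq → total p q (s≤s (≤-trans (E≤D+D-light (λ _ _ → refl) p q)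
                                             (average {D p} {D q} Pp Pq))))
      covered
    where
    -- Every edge has few enough crossings for `total` to orient it directly, so no edge is heavy.
    open Arcs (λ _ _ → true) (λ _ _ → refl) (λ x y h _ → total x y (s≤s (planar x y h)))
    average : ∀ {x y} → x + x ≤ k → y + y ≤ k → x + y ≤ k
    average {x} {y} hx hy with ≤-total x y
    ... | inj₁ x≤y = ≤-trans (+-monoˡ-≤ y x≤y) hy
    ... | inj₂ y≤x = ≤-trans (+-monoʳ-≤ x y≤x) hx
    covered : ∀ r → ¬ D r + D r ≤ k →
              ∃₂ λ a b → Small a b × Btw a r b × (D a + D a ≤ k ⊎ D b + D b ≤ k)
    covered r r∉ =
      -- A point of depth 0 belongs to P, so some arc covers `r`.
      let x , y , xry , M = maximal r (≰⇒> λ D≤0 → r∉ (≤-trans (+-mono-≤ D≤0 D≤0) z≤n))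
          xy = Maximal.isArc M
          D+D≤k = ≤-trans (m≤m+n (D x + D y) (U# x y))
                    (≤-trans (D+D≤E M) (planar x y (A⇒adj x y xy)))
      in x , y , A⇒Small x y xy , xry , half-≤ {D x} {D y} D+D≤k

  -- The contradiction for min-k-planar drawings.

  module MinKPlanar (k : ℕ) (1≤k : 1 ≤ k)
    (planar : ∀ u v x y → adj u v ≡ true → adj x y ≡ true → across u v x y ≡ true →
              E u v ≤ k ⊎ E x y ≤ k)
    (total : ∀ p q → E p q < 2 * k → Small p q ⊎ Small q p) where

    double : 2 * k ≡ k + k
    double = cong (k +_) (+-identityʳ k)

    k<2k : k < 2 * k
    k<2k = subst (k <_) (sym double) (m<m+n k 1≤k)

    light : Fin n → Fin n → Bool
    light x y = does (E x y ≤? k)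

    light-sym : ∀ x y → light x y ≡ light y x
    light-sym x y = cong (λ e → does (e ≤? k)) (E-sym x y)

    light⇒≤ : ∀ x y → light x y ≡ true → E x y ≤ k
    light⇒≤ x y = does-sound (E x y ≤? k)

    -- First round: only light edges are oriented, since only they have fewer than 2k crossings by
    -- definition.
    module Lights = Arcs light light-sym (λ x y _ l → total x y (≤-<-trans (light⇒≤ x y l) k<2k))

    module _ where
      open Lights

      U⇒ : ∀ x y → U x y ≡ true → adj x y ≡ true × ¬ E x y ≤ k
      U⇒ x y h with ∧-true {adj x y} h
      ... | h₁ , h₂ = h₁ , λ le → not-true h₂ (dec-true (E x y ≤? k) le)

      U-sym : ∀ x y → U x y ≡ U y x
      U-sym x y = cong₂ (λ a b → a ∧ not b) (adj-sym x y) (light-sym x y)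

      heavy-noncrossing : ∀ a b c d → U a b ≡ true → U c d ≡ true → ¬ across a b c d ≡ true
      heavy-noncrossing a b c d ab cd h =
        [ proj₂ (U⇒ a b ab) , proj₂ (U⇒ c d cd) ]′
          (planar a b c d (proj₁ (U⇒ a b ab)) (proj₁ (U⇒ c d cd)) h)

      -- Heavy edges occur in both directions. Counting both makes crossing symmetric in `a` and
      -- `b`, so chords can be compared term by term; the price is a factor 2, cancelled afterwards.
      X : Fin n → Fin n → Fin n → Fin n → ℕ
      X p q a b = bit (U a b ∧ across p q a b) + bit (U a b ∧ across p q b a)

      U#+U# : ∀ p q → U# p q + U# p q ≡ sum₂ (X p q)
      U#+U# p q = trans (cong (U# p q +_) reversed)
                        (sym (sum₂-+ (λ a b → bit (U a b ∧ across p q a b)) _))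
        where
        reversed : U# p q ≡ sum₂ λ a b → bit (U a b ∧ across p q b a)
        reversed = trans (sum-swap λ a b → bit (U a b ∧ across p q a b))
          (sum₂-cong λ a b → cong (λ c → bit (c ∧ across p q b a)) (U-sym b a))

      Crossing : Fin n → Fin n → Fin n → Fin n → Set
      Crossing p q a b = across p q a b ≡ true ⊎ across p q b a ≡ true

      Crossing? : ∀ p q a b → Dec (Crossing p q a b)
      Crossing? p q a b = (_ Bool.≟ true) ⊎-dec (_ Bool.≟ true)

      NC : Fin n → Fin n → Fin n → Fin n → Set
      NC p q a b = NonCrossing (pos p) (pos q) (pos a) (pos b)

      ¬Crossing⇒NC : ∀ p q a b → ¬ Crossing p q a b → NC p q a b
      ¬Crossing⇒NC p q a b h =
        (λ h₁ h₂ → h (inj₁ (true-∧ h₁ h₂))) , (λ h₁ h₂ → h (inj₂ (true-∧ h₁ h₂)))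

      NC⇒¬Crossing : ∀ p q a b → NC p q a b → ¬ Crossing p q a b
      NC⇒¬Crossing p q a b (f , g) (inj₁ h) with ∧-true {between p a q} h
      ... | h₁ , h₂ = f h₁ h₂
      NC⇒¬Crossing p q a b (f , g) (inj₂ h) with ∧-true {between p b q} h
      ... | h₁ , h₂ = g h₁ h₂

      X≤1 : ∀ p q a b → X p q a b ≤ 1
      X≤1 p q a b with U a b ∧ across p q a b in e
      ... | false = bit-≤1 _
      ... | true with U a b ∧ across p q b a in e′
      ...   | false = ≤-refl
      ...   | true = ⊥-elim (Between-asym (pos p) (pos q) (pos a)
        (proj₁ (∧-true (proj₂ (∧-true {U a b} e))))
        (proj₂ (∧-true {between p b q} (proj₂ (∧-true {U a b} e′)))))

      X≥1 : ∀ p q a b → U a b ≡ true → Crossing p q a b → 1 ≤ X p q a b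
      X≥1 p q a b h (inj₁ c) rewrite h | c = s≤s z≤n
      X≥1 p q a b h (inj₂ c) rewrite h | c = m≤n+m 1 _

      X≡0 : ∀ p q a b → U a b ≡ false ⊎ ¬ Crossing p q a b → X p q a b ≡ 0
      X≡0 p q a b (inj₁ h) rewrite h = refl
      X≡0 p q a b (inj₂ ¬c) with U a b
      ... | false = refl
      ... | true with across p q a b | across p q b a
      ...   | false | false = refl
      ...   | true  | _     = ⊥-elim (¬c (inj₁ refl))
      ...   | false | true  = ⊥-elim (¬c (inj₂ refl))

      X-bound : ∀ p q s t s′ t′ →
        (∀ a b → U a b ≡ true → Crossing p q a b → Crossing s t a b ⊎ Crossing s′ t′ a b) →
        ∀ a b → X p q a b ≤ X s t a b + X s′ t′ a b
      X-bound p q s t s′ t′ f a b with U a b Bool.≟ true | Crossing? p q a b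
      ... | no ¬u | _ = ≤-trans (≤-reflexive (X≡0 p q a b (inj₁ (¬-not ¬u)))) z≤n
      ... | yes _ | no ¬c = ≤-trans (≤-reflexive (X≡0 p q a b (inj₂ ¬c))) z≤n
      ... | yes u | yes c with f a b u c
      ...   | inj₁ c₁ =
        ≤-trans (X≤1 p q a b) (≤-trans (X≥1 s t a b u c₁) (m≤m+n (X s t a b) (X s′ t′ a b)))
      ...   | inj₂ c₂ =
        ≤-trans (X≤1 p q a b) (≤-trans (X≥1 s′ t′ a b u c₂) (m≤n+m (X s′ t′ a b) (X s t a b)))

      module _ {p q s t s′ t′ : Fin n}
        (f : ∀ a b → U a b ≡ true → Crossing p q a b → Crossing s t a b ⊎ Crossing s′ t′ a b) where

        private
          doubled : sum₂ (λ a b → X s t a b + X s′ t′ a b)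
                  ≡ (U# s t + U# s′ t′) + (U# s t + U# s′ t′)
          doubled = trans (sum₂-+ (X s t) (X s′ t′))
            (trans (sym (cong₂ _+_ (U#+U# s t) (U#+U# s′ t′)))
                   (interchange +-commutativeSemigroup (U# s t) (U# s t) (U# s′ t′) (U# s′ t′)))

        U#-≤ : U# p q ≤ U# s t + U# s′ t′
        U#-≤ = double-≤-cancel (subst₂ _≤_ (sym (U#+U# p q)) doubled
                 (sum₂-mono (X-bound p q s t s′ t′ f)))

        -- The edge uv contributes at most once on the left but to both terms on the right.
        U#-< : ∀ u v → U u v ≡ true → Crossing s t u v → Crossing s′ t′ u v →
               U# p q < U# s t + U# s′ t′
        U#-< u v h c c′ = double-<-cancel (subst₂ _<_ (sym (U#+U# p q)) doubled
          (sum₂-mono-< (X-bound p q s t s′ t′ f) u v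
            (≤-<-trans (X≤1 p q u v) (+-mono-≤ (X≥1 s t u v h c) (X≥1 s′ t′ u v h c′)))))

      -- A maximal light arc [s, t] over the endpoint u of the heavy edge uv, or u itself if
      -- no light arc covers it.
      record Anchor (u v : Fin n) : Set where
        field
          s t      : Fin n
          small    : Small s t
          on       : On s t u
          bound    : D s + D t + U# s t ≤ k
          side     : ∀ a b → NC s t a b → On a b u → On a b v → On a b s × On a b t
          tight    : D s + D t + U# s t ≡ 0 ⊎ Crossing s t u v

      Small-pair : ∀ s t u v → Small s t → On s t u → On s t v → Small u v ⊎ Small v u
      Small-pair s t u v st u∈ v∈ = Sum.map (λ h → shrink h v∈) (λ h → shrink h u∈)
        (In-comparable (pos s) (pos t) (pos u) (pos v) u∈ v∈)
        where
        shrink : ∀ {u v} → On s v u → On s t v → Small u v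
        shrink {u} {v} h h′ = Small-⊆ (λ z → In-prefix (pos s) (pos v) (pos t) (pos z) h′
          ∘ In-suffix (pos s) (pos u) (pos v) (pos z) h) st

      U#-self : ∀ u → U# u u ≡ 0
      U#-self u = n≤0⇒n≡0 (subst (U# u u ≤_)
        (trans (sum-cong {n} (λ _ → sum-0 n)) (sum-0 n))
        (sum₂-mono λ a b → bit-mono {b = false} λ h →
          ⊥-elim (Between-irrefl (pos u) (pos a) (proj₁ (∧-true (proj₂ (∧-true {U a b} h)))))))

      E-self : ∀ u → D u ≡ 0 → E u u ≤ 0
      E-self u D≡0 = subst (E u u ≤_) (cong₂ _+_ (cong₂ _+_ D≡0 D≡0) (U#-self u)) (E≤D+D u u)

      -- When a light arc [s, t] covers `u`, it cannot contain `v`, since its part between `u` and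
      -- `v` would be a small arc; hence uv crosses st.
      anchor : ∀ u v → ¬ (Small u v ⊎ Small v u) → Dec (1 ≤ D u) → Anchor u v
      anchor u v ¬small (no D≱1) = record
        { s = u ; t = u
        ; small = [ id , id ]′ (total u u (≤-<-trans (≤-trans (E-self u D≡0) z≤n) k<2k))
        ; on    = In-start (pos u) (pos u)
        ; bound = ≤-trans (≤-reflexive β≡0) z≤n
        ; side  = λ a b _ u∈ _ → u∈ , u∈
        ; tight = inj₁ β≡0
        }
        where
        D≡0 : D u ≡ 0
        D≡0 = n≤0⇒n≡0 (≤-pred (≰⇒> D≱1))
        β≡0 : D u + D u + U# u u ≡ 0
        β≡0 = cong₂ _+_ (cong₂ _+_ D≡0 D≡0) (U#-self u)
      anchor u v ¬small (yes D≥1) =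
        let s , t , sut , M = maximal u D≥1
            st  = Maximal.isArc M
            sst = A⇒Small s t st
            u∈  = Between⇒In (pos s) (pos t) (pos u) sut
            tvs = [ (λ e → ⊥-elim (maximal-distinct M e)) , id ]′
                    (¬In⇒Between (pos s) (pos t) (pos v) (¬small ∘ Small-pair s t u v sst u∈))
        in record
        { s = s ; t = t
        ; small = sst
        ; on    = u∈
        ; bound = ≤-trans (D+D≤E M) (light⇒≤ s t (A⇒light s t st))
        ; side  = λ a b → crossing-same-side (pos s) (pos t) (pos u) (pos v) (pos a) (pos b) sut tvs
        ; tight = inj₂ (inj₁ (true-∧ sut tvs))
        }

      module Connect {u v : Fin n} (uv : U u v ≡ true) (F : Anchor u v) (F′ : Anchor v u) where

        open Anchor F
        open Anchor F′ using () renaming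
          (s to s′; t to t′; small to small′; on to on′; bound to bound′; side to side′; tight to tight′)

        sides : ∀ {a b p q} → p ≡ s ⊎ p ≡ t → q ≡ s′ ⊎ q ≡ t′ → NC s t a b → NC s′ t′ a b →
                On a b u × On a b v → NC p q a b
        sides {a} {b} {p} {q} p∈ q∈ nc nc′ (u∈ , v∈) =
          noncrossing (pos p) (pos q) (pos a) (pos b) (choose p∈ (side a b nc u∈ v∈))
                                                     (choose q∈ (side′ a b nc′ v∈ u∈))
          where
          choose : ∀ {p s t} → p ≡ s ⊎ p ≡ t → On a b s × On a b t → On a b p
          choose (inj₁ refl) = proj₁
          choose (inj₂ refl) = proj₂

        -- Heavy edges do not cross, so u and v are on one side of ab. If ab also misses st and
        -- s′t′, all four anchor ends are on that side, and so is the chord pq.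
        crossed : ∀ {p q} → p ≡ s ⊎ p ≡ t → q ≡ s′ ⊎ q ≡ t′ → ∀ a b → U a b ≡ true →
                  Crossing p q a b → Crossing s t a b ⊎ Crossing s′ t′ a b
        crossed {p} {q} p∈ q∈ a b ab c = go (Crossing? s t a b) (Crossing? s′ t′ a b)
          where
          uv-nc : NC u v a b
          uv-nc = ¬Crossing⇒NC u v a b
            [ heavy-noncrossing u v a b uv ab , heavy-noncrossing u v b a uv (trans (U-sym b a) ab) ]′
          a≢b : ¬ pos a ≡ pos b
          a≢b e = adj-distinct a b (proj₁ (U⇒ a b ab)) (pos-injective e)
          swap : ∀ {a b c d} → NC a b c d → NC a b d c
          swap (f , g) = g , f
          go : Dec (Crossing s t a b) → Dec (Crossing s′ t′ a b) → Crossing s t a b ⊎ Crossing s′ t′ a b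
          go (yes c₁) _        = inj₁ c₁
          go (no _)   (yes c₂) = inj₂ c₂
          go (no ¬c₁) (no ¬c₂) = ⊥-elim (NC⇒¬Crossing p q a b
            ([ sides p∈ q∈ nc nc′
             , swap {p} {q} {b} {a}
                 ∘ sides p∈ q∈ (swap {s} {t} {a} {b} nc) (swap {s′} {t′} {a} {b} nc′)
             ]′ (same-side (pos u) (pos v) (pos a) (pos b) a≢b uv-nc)) c)
            where
            nc  = ¬Crossing⇒NC s t a b ¬c₁
            nc′ = ¬Crossing⇒NC s′ t′ a b ¬c₂

        β β′ : ℕ
        β  = D s + D t + U# s t
        β′ = D s′ + D t′ + U# s′ t′

        D-endpoint : ∀ {p s t} → p ≡ s ⊎ p ≡ t → D p ≤ D s + D t
        D-endpoint {s = s} {t} (inj₁ refl) = m≤m+n (D s) (D t)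
        D-endpoint {s = s} {t} (inj₂ refl) = m≤n+m (D t) (D s)

        regroup : (D s + D t + (D s′ + D t′)) + (U# s t + U# s′ t′) ≡ β + β′
        regroup = interchange +-commutativeSemigroup (D s + D t) (D s′ + D t′) (U# s t) (U# s′ t′)

        module _ {p q} (p∈ : p ≡ s ⊎ p ≡ t) (q∈ : q ≡ s′ ⊎ q ≡ t′) where

          E≤β+β′ : E p q ≤ β + β′
          E≤β+β′ = ≤-trans (E≤D+D p q) (subst (D p + D q + U# p q ≤_) regroup
            (+-mono-≤ (+-mono-≤ (D-endpoint p∈) (D-endpoint q∈)) (U#-≤ (crossed p∈ q∈))))

          -- Two genuine light arcs both cross uv, so uv is counted twice in β + β′.
          E<2k : β ≡ 0 ⊎ Crossing s t u v → β′ ≡ 0 ⊎ Crossing s′ t′ v u → E p q < 2 * k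
          E<2k (inj₁ β≡0) _ =
            ≤-<-trans E≤β+β′ (≤-<-trans (+-mono-≤ (≤-reflexive β≡0) bound′) k<2k)
          E<2k (inj₂ _) (inj₁ β′≡0) =
            ≤-<-trans E≤β+β′ (≤-<-trans (+-mono-≤ bound (≤-reflexive β′≡0))
              (subst (_< 2 * k) (sym (+-identityʳ k)) k<2k))
          E<2k (inj₂ c) (inj₂ c′) = <-≤-trans
            (≤-<-trans (E≤D+D p q) (subst (D p + D q + U# p q <_) regroup
              (+-mono-≤-< (+-mono-≤ (D-endpoint p∈) (D-endpoint q∈))
                          (U#-< (crossed p∈ q∈) u v uv c (Sum.swap c′)))))
            (subst (β + β′ ≤_) (sym double) (+-mono-≤ bound bound′))

          connected : Small p q ⊎ Small q p
          connected = total p q (E<2k tight tight′)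

        -- The chords joining the two anchors make their ends comparable, so the anchors have a
        -- small hull. It contains u and v, and one of the arcs between them lies inside it.
        common : Small u v ⊎ Small v u
        common = [ (λ ss′ → finish (Small-hull s t s′ t′ small small′ ss′
                              (connected (inj₂ refl) (inj₂ refl)) (connected (inj₁ refl) (inj₂ refl))))
                 , (λ s′s → finish (swap (Small-hull s′ t′ s t small′ small s′s
                              (Sum.swap (connected (inj₂ refl) (inj₂ refl)))
                              (Sum.swap (connected (inj₂ refl) (inj₁ refl))))))
                 ]′ (connected (inj₁ refl) (inj₁ refl))
          where
          Hull : Fin n → Fin n → Fin n → Fin n → Set
          Hull s t s′ t′ = ∃₂ λ c d → Small c d × ((s , t) ⊆ₐ (c , d)) × ((s′ , t′) ⊆ₐ (c , d))
          swap : Hull s′ t′ s t → Hull s t s′ t′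
          swap (c , d , cd , f , g) = c , d , cd , g , f
          finish : Hull s t s′ t′ → Small u v ⊎ Small v u
          finish (c , d , cd , f , g) = Small-pair c d u v cd (f u on) (g v on′)

      -- Assuming the contrary is what makes both anchors available.
      heavy-small : ∀ u v → U u v ≡ true → Small u v ⊎ Small v u
      heavy-small u v uv = decidable-stable (Small? u v ⊎-dec Small? v u) λ ¬small →
        ¬small (Connect.common uv (anchor u v ¬small (1 ≤? D u))
                                  (anchor v u (¬small ∘ Sum.swap) (1 ≤? D v)))

    orient : ∀ x y → adj x y ≡ true → true ≡ true → Small x y ⊎ Small y x
    orient x y h _ = go (light x y) refl
      where
      go : ∀ b → light x y ≡ b → Small x y ⊎ Small y x
      go true  l = total x y (≤-<-trans (light⇒≤ x y l) k<2k)
      go false l = heavy-small x y (true-∧ h (cong not l))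

    -- Second round: `A`, `D` and `Maximal` now refer to all edges, heavy ones included.
    open Arcs (λ _ _ → true) (λ _ _ → refl) orient

    -- Strictness at one end already gives fewer than 2k crossings; this admits ends just outside P,
    -- such as `t` in `heavy-covered`.
    total′ : ∀ p q → D p ≤ k → D q < k → Small p q ⊎ Small q p
    total′ p q hp hq =
      total p q (≤-<-trans (E≤D+D-light (λ _ _ → refl) p q)
                           (subst (D p + D q <_) (sym double) (+-mono-≤-< hp hq)))

    D+D≤k : ∀ {x y} → Maximal x y → E x y ≤ k → D x + D y ≤ k
    D+D≤k {x} {y} M le = ≤-trans (m≤m+n (D x + D y) (U# x y)) (≤-trans (D+D≤E M) le)

    Covered : Fin n → Set
    Covered r = ∃₂ λ a b → Small a b × Btw a r b × (D a < k ⊎ D b < k)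

    crossing-light : ∀ a b c d → adj a b ≡ true → adj c d ≡ true → ¬ E a b ≤ k →
                     across a b c d ≡ true → E c d ≤ k
    crossing-light a b c d ab cd heavy h = [ ⊥-elim ∘ heavy , id ]′ (planar a b c d ab cd h)

    -- A maximal heavy arc [x, y] with both endpoints covered is crossed by maximal light
    -- arcs [s, t] over x and [s′, t′] over y, and then their hull [s, t′] is small.
    module HeavyCovered (r : Fin n) {x y s t s′ t′ : Fin n} (xry : Btw x r y)
      (sxt : Btw s x t) (s′yt′ : Btw s′ y t′)
      (M : Maximal x y) (F : Maximal s t) (F′ : Maximal s′ t′) (heavy : ¬ E x y ≤ k) where

      open Maximal M using () renaming (isArc to xy)
      open Maximal F using () renaming (isArc to st)
      open Maximal F′ using () renaming (isArc to s′t′)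

      xty : Btw x t y
      xty = proj₁ (cross-start M s t st sxt)

      ysx : Btw y s x
      ysx = proj₂ (cross-start M s t st sxt)

      xs′y : Btw x s′ y
      xs′y = proj₁ (cross-end M s′ t′ s′t′ s′yt′)

      yt′x : Btw y t′ x
      yt′x = proj₂ (cross-end M s′ t′ s′t′ s′yt′)

      Ds+Dt≤k : D s + D t ≤ k
      Ds+Dt≤k = D+D≤k F (subst (_≤ k) (E-sym t s)
        (crossing-light x y t s (A⇒adj x y xy) (trans (adj-sym t s) (A⇒adj s t st)) heavy
          (true-∧ xty ysx)))

      Ds′+Dt′≤k : D s′ + D t′ ≤ k
      Ds′+Dt′≤k = D+D≤k F′
        (crossing-light x y s′ t′ (A⇒adj x y xy) (A⇒adj s′ t′ s′t′) heavy (true-∧ xs′y yt′x))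

      -- The heavy arc [x, y] itself covers `t`, which takes one unit from the bound on `D s + D t`.
      Ds<k : D s < k
      Ds<k = ≤-trans (≤-trans (≤-reflexive (+-comm 1 (D s))) (+-monoʳ-≤ (D s) (D≥1 t x y xy xty)))
               Ds+Dt≤k

      Dt≤k : D t ≤ k
      Dt≤k = ≤-trans (m≤n+m (D t) (D s)) Ds+Dt≤k

      Dt′<k : D t′ < k
      Dt′<k = ≤-trans (+-monoˡ-≤ (D t′) (D≥1 s′ x y xy xs′y)) Ds′+Dt′≤k

      heavy-covered : Covered r
      heavy-covered = [ hull , ⊥-elim ∘ detour ]′ (total′ t t′ Dt≤k Dt′<k)
        where
        hull : Small t t′ → Covered r
        hull tt′ = s , t′ , st′ ,
          between-hull (pos x) (pos y) (pos s) (pos t) (pos t′) (pos r) xty ysx yt′x t∈ xry ,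
          inj₁ Ds<k
          where
          st′ : Small s t′
          st′ = Small-trans s t t′ (A⇒Small s t st) tt′ (total′ s t′ (<⇒≤ Ds<k) Dt′<k)
          t∈ : On s t′ t
          t∈ = proj₁ (Small-join s t t′ (A⇒Small s t st) tt′ st′) t (In-end (pos s) (pos t))
        -- The arc from t′ to t spans the far side from y's arc to past `x`; with [x, y] and
        -- [s′, t′] it closes the circle.
        detour : ¬ Small t′ t
        detour t′t = no-cover t′t (A⇒Small x y xy) (A⇒Small s′ t′ s′t′) λ z →
          In-detour (pos x) (pos y) (pos s′) (pos t) (pos t′) (pos z) xty yt′x s′yt′

    maximal-covered : ∀ r {x y} → Btw x r y → Maximal x y →
                      Dec (E x y ≤ k) → Dec (D x < k) → Dec (D y < k) → Covered r
    maximal-covered r {x} {y} xry M _ (yes h) _ = x , y , A⇒Small x y (Maximal.isArc M) , xry , inj₁ h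
    maximal-covered r {x} {y} xry M _ _ (yes h) = x , y , A⇒Small x y (Maximal.isArc M) , xry , inj₂ h
    -- A light maximal arc with both ends outside P would give 2k ≤ k.
    maximal-covered r {x} {y} xry M (yes le) (no h) (no h′) = ⊥-elim (<⇒≱ k<2k
      (subst (_≤ k) (sym double) (≤-trans (+-mono-≤ (≮⇒≥ h) (≮⇒≥ h′)) (D+D≤k M le))))
    -- Both ends have depth at least k, hence at least 1, so each is covered by a maximal arc.
    maximal-covered r {x} {y} xry M (no heavy) (no h) (no h′) =
      go (maximal x (≤-trans 1≤k (≮⇒≥ h))) (maximal y (≤-trans 1≤k (≮⇒≥ h′)))
      where
      go : (∃₂ λ s t → Btw s x t × Maximal s t) → (∃₂ λ s t → Btw s y t × Maximal s t) → Covered r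
      go (s , t , sxt , F) (s′ , t′ , s′yt′ , F′) =
        HeavyCovered.heavy-covered r xry sxt s′yt′ M F F′ heavy

    covered : ∀ r → ¬ D r < k → Covered r
    covered r h = go (maximal r (≤-trans 1≤k (≮⇒≥ h)))
      where
      go : (∃₂ λ x y → Btw x r y × Maximal x y) → Covered r
      go (x , y , xry , M) = maximal-covered r xry M (E x y ≤? k) (D x <? k) (D y <? k)

    minKPlanar-impossible : ⊥
    minKPlanar-impossible =
      covering-impossible (λ p → D p <? k) z₀ (λ p q hp hq → total′ p q (<⇒≤ hp) hq) covered

-- From cyclic order to the crossing test of the drawing.

<ᵇ-true : ∀ {a b} → a < b → (a <ᵇ b) ≡ true
<ᵇ-true {a} {b} lt with a <ᵇ b | <⇒<ᵇ lt
... | true | _ = refl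

<ᵇ-false : ∀ {a b} → b < a → (a <ᵇ b) ≡ false
<ᵇ-false {a} {b} lt with a <ᵇ b in e
... | false = refl
... | true  = ⊥-elim (<-asym lt (<ᵇ⇒< a b (subst Bool.T (sym e) _)))

private
  -- What remains of `cyc` once the outer points are compared: lying inside their interval if they
  -- increase, and outside it, as in `either`, if they decrease.
  both : ∀ x y → (x ∧ y) ∨ (y ∧ false) ∨ (false ∧ x) ≡ true → x ∧ y ≡ true
  both true  true  _ = refl
  both true  false ()
  both false true  ()
  both false false ()

  either : ∀ x y → (x ∧ y) ∨ (y ∧ true) ∨ (true ∧ x) ≡ true → y ∨ x ≡ true
  either x     true  _ = refl
  either true  false _ = refl
  either false false ()

opaque
  unfolding cyc

  across⇒crosses : ∀ a b c d → cyc a c b ≡ true → cyc b d a ≡ true →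
    (Defs.inside a b c ∧ Defs.outside a b d) ∨ (Defs.outside a b c ∧ Defs.inside a b d) ≡ true
  across⇒crosses a b c d h₁ h₂ with <-cmp a b
  ... | tri≈ _ refl _ = ⊥-elim (Between-irrefl a c h₁)
  ... | tri< a<b _ _ rewrite <ᵇ-true a<b | <ᵇ-false a<b =
    true-∨ˡ (true-∧ (both (a <ᵇ c) (c <ᵇ b) h₁) (either (b <ᵇ d) (d <ᵇ a) h₂))
  ... | tri> _ _ b<a rewrite <ᵇ-true b<a | <ᵇ-false b<a =
    true-∨ʳ (true-∧ (either (a <ᵇ c) (c <ᵇ b) h₁) (both (b <ᵇ d) (d <ᵇ a) h₂))

-- Separations of a subgraph given by Boolean predicates.

∣∣≡count : ∀ {n} (S : Subset n) → ∣ S ∣ ≡ count (lookup S)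
∣∣≡count []            = refl
∣∣≡count (inside ∷ S)  = cong suc (∣∣≡count S)
∣∣≡count (outside ∷ S) = ∣∣≡count S

∣∣≤count : ∀ {n} (S : Subset n) (f : Fin n → Bool) → (∀ {z} → z ∈ S → f z ≡ true) → ∣ S ∣ ≤ count f
∣∣≤count S f h = ≤-trans (≤-reflexive (∣∣≡count S)) (count-mono λ z e → h (lookup⇒[]= z S e))

x∈p─q⇒x∉q : ∀ {n} {p q : Subset n} {x} → x ∈ p ─ q → x ∉ q
x∈p─q⇒x∉q {p = _ ∷ _} {inside ∷ q}  ()        here
x∈p─q⇒x∉q {p = _ ∷ _} {_ ∷ q}       (there h) (there h′) = x∈p─q⇒x∉q h h′

module _ {n} (f : Fin n → Bool) where

  ∈-tabulate⁺ : ∀ {z} → f z ≡ true → z ∈ tabulate f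
  ∈-tabulate⁺ {z} h = lookup⇒[]= z _ (trans (lookup∘tabulate f z) h)

  ∈-tabulate⁻ : ∀ {z} → z ∈ tabulate f → f z ≡ true
  ∈-tabulate⁻ {z} h = trans (sym (lookup∘tabulate f z)) ([]=⇒lookup h)

module OfSubgraph {n} {G : Graph n} (H : Subgraph G) where

  V : Fin n → Bool
  V = lookup (verts H)

  Separates : ℕ → Set
  Separates s = Σ (Subset n) λ A → Σ (Subset n) λ B →
    IsSeparation H A B × IsBalanced H A B × ∣ A ∩ B ∣ ≤ s

  -- The predicates `f`, `g` and `h` bound the two differences and the intersection from above, so
  -- supersets that are easier to count may be used.
  separates : ∀ {s} (a b f g h : Fin n → Bool) →
    (∀ z → V z ≡ true → a z ≡ true ⊎ b z ≡ true) →
    (∀ z → a z ≡ true → V z ≡ true) → (∀ z → b z ≡ true → V z ≡ true) →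
    (∀ u v → hadj H u v ≡ true → a u ≡ true → ¬ b u ≡ true → b v ≡ true → ¬ a v ≡ true → ⊥) →
    (∀ z → a z ≡ true → ¬ b z ≡ true → f z ≡ true) → 3 * count f ≤ 2 * count V →
    (∀ z → b z ≡ true → ¬ a z ≡ true → g z ≡ true) → 3 * count g ≤ 2 * count V →
    (∀ z → a z ≡ true → b z ≡ true → h z ≡ true) → count h ≤ s →
    Separates s
  separates a b f g h cover a⊆V b⊆V no-edge f-bound f≤ g-bound g≤ h-bound h≤ =
    A , B ,
    (⊆-antisym (λ z∈ → [ into-V a⊆V , into-V b⊆V ]′ (x∈p∪q⁻ A B z∈))
               (λ {z} z∈ → x∈p∪q⁺ (Sum.map (∈-tabulate⁺ a) (∈-tabulate⁺ b) (cover z ([]=⇒lookup z∈)))) ,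
     λ u v uv u∈ v∈ → no-edge u v uv (∈-tabulate⁻ a (p─q⊆p A B u∈)) (x∈p─q⇒x∉q u∈ ∘ ∈-tabulate⁺ b)
                                     (∈-tabulate⁻ b (p─q⊆p B A v∈)) (x∈p─q⇒x∉q v∈ ∘ ∈-tabulate⁺ a)) ,
    (subst (λ W → 3 * ∣ A ─ B ∣ ≤ 2 * W) (sym (∣∣≡count (verts H)))
       (≤-trans (*-monoʳ-≤ 3 (∣∣≤count (A ─ B) f λ {z} z∈ →
          f-bound z (∈-tabulate⁻ a (p─q⊆p A B z∈)) (x∈p─q⇒x∉q z∈ ∘ ∈-tabulate⁺ b))) f≤) ,
     subst (λ W → 3 * ∣ B ─ A ∣ ≤ 2 * W) (sym (∣∣≡count (verts H)))
       (≤-trans (*-monoʳ-≤ 3 (∣∣≤count (B ─ A) g λ {z} z∈ →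
          g-bound z (∈-tabulate⁻ b (p─q⊆p B A z∈)) (x∈p─q⇒x∉q z∈ ∘ ∈-tabulate⁺ a))) g≤)) ,
    ≤-trans (∣∣≤count (A ∩ B) h λ {z} z∈ →
      h-bound z (∈-tabulate⁻ a (proj₁ (x∈p∩q⁻ A B z∈))) (∈-tabulate⁻ b (proj₂ (x∈p∩q⁻ A B z∈)))) h≤
    where
    A B : Subset n
    A = tabulate a
    B = tabulate b
    into-V : ∀ {c z} → (∀ z → c z ≡ true → V z ≡ true) → z ∈ tabulate c → z ∈ verts H
    into-V {c} {z} c⊆V z∈ = lookup⇒[]= z _ (c⊆V z (∈-tabulate⁻ c z∈))

  -- Up to two vertices fit into the separator entirely.
  few-vertices : ∀ {s} → 2 ≤ s → count V ≤ 3 → Separates s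
  few-vertices {s} 2≤s W≤3 with count V ≤? 2
  ... | yes W≤2 = separates V V (λ _ → false) (λ _ → false) V
    (λ z → inj₁) (λ z → id) (λ z → id) (λ u v _ h ¬h _ _ → ¬h h)
    (λ z h ¬h → ⊥-elim (¬h h)) none (λ z h ¬h → ⊥-elim (¬h h)) none
    (λ z h _ → h) (≤-trans W≤2 2≤s)
    where
    none : 3 * count {n} (λ _ → false) ≤ 2 * count V
    none = ≤-trans (≤-reflexive (cong (3 *_) (count-false n))) z≤n
  ... | no W≰2 = go (sum-positive (λ z → bit (V z)) (subst (1 ≤_) (count≡sum V) (≤-trans (s≤s z≤n) W≥3)))
    where
    W≥3 : 3 ≤ count V
    W≥3 = ≰⇒> W≰2
    none : 3 * count {n} (λ _ → false) ≤ 2 * count V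
    none = ≤-trans (≤-reflexive (cong (3 *_) (count-false n))) z≤n
    go : (∃ λ x → 1 ≤ bit (V x)) → Separates s
    -- With three vertices, only `x` is left out of the second set: one difference is a single
    -- vertex, the other is empty, and the separator has two vertices.
    go (x , Vx) = separates V V-x is-x (λ _ → false) V-x
      (λ z → inj₁) (λ z → id) (λ z → proj₁ ∘ ∧-true) (λ u v _ _ _ h ¬h → ¬h (proj₁ (∧-true h)))
      (λ z h ¬h → decidable-stable (is-x z Bool.≟ true) λ ¬x → ¬h (true-∧ h (true-not ¬x)))
      (≤-trans (*-monoʳ-≤ 3 (count-unique x λ z → does-sound (z Fin.≟ x)))
               (≤-trans (s≤s (s≤s (s≤s z≤n))) (*-monoʳ-≤ 2 W≥3)))
      (λ z h ¬h → ⊥-elim (¬h (proj₁ (∧-true h)))) none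
      (λ z _ h → h) (≤-trans (≤-pred (≤-trans V-x<V W≤3)) 2≤s)
      where
      is-x V-x : Fin n → Bool
      is-x z = does (z Fin.≟ x)
      V-x z  = V z ∧ not (is-x z)
      Vx≡ : V x ≡ true
      Vx≡ = bit-positive Vx
      V-x<V : count V-x < count V
      V-x<V = count-mono-< (λ z → proj₁ ∘ ∧-true) x
        (λ h → not-true (proj₂ (∧-true {V x} h)) (dec-true (x Fin.≟ x) refl)) Vx≡

  -- Balanced chords of a convex drawing.

  module Drawn (π : ConvexDrawing n) where

    hadj-irrefl : ∀ v → hadj H v v ≡ false
    hadj-irrefl v with hadj H v v in e
    ... | false = refl
    ... | true with trans (sym (irrefl G v)) (hsub H v v e)
    ...   | ()

    pos-injective : ∀ {u v} → pos π u ≡ pos π v → u ≡ v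
    pos-injective {u} {v} e =
      trans (sym (inverseˡ π)) (trans (cong (π ⟨$⟩ˡ_) (toℕ-injective e)) (inverseˡ π))

    open EdgeCount (pos π) pos-injective V (hadj H) (hsym H) hadj-irrefl

    across-between : ∀ p q x y → across p q x y ≡ true → Btw p x q × Btw q y p
    across-between p q x y = ∧-true

    crossing-edge : ∀ p q x y → hadj H x y ≡ true → across p q x y ≡ true →
                    adj G x y ∧ crosses π p q x y ≡ true
    crossing-edge p q x y xy h = true-∧ (hsub H x y xy)
      (let h₁ , h₂ = across-between p q x y h
       in across⇒crosses (pos π p) (pos π q) (pos π x) (pos π y) h₁ h₂)

    crossing-edge′ : ∀ p q x y → hadj H y x ≡ true → across p q y x ≡ true →
                     adj G x y ∧ crosses π p q x y ≡ true
    crossing-edge′ p q x y yx h = true-∧ (trans (Graph.sym G x y) (hsub H y x yx))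
      (swap {ins y} {outs x} {outs y} {ins x}
        (across⇒crosses (pos π p) (pos π q) (pos π y) (pos π x) (proj₁ h′) (proj₂ h′)))
      where
      h′ = across-between p q y x h
      ins outs : Fin n → Bool
      ins z  = Defs.inside (pos π p) (pos π q) (pos π z)
      outs z = Defs.outside (pos π p) (pos π q) (pos π z)
      swap : ∀ {a b c d} → (a ∧ b) ∨ (c ∧ d) ≡ true → (d ∧ c) ∨ (b ∧ a) ≡ true
      swap {a} {b} {c} {d} h = trans (∨-comm (d ∧ c) (b ∧ a))
        (trans (cong₂ _∨_ (∧-comm b a) (∧-comm d c)) h)

    -- `E` selects the order of an edge's ends by their side of pq, `crossNum` by vertex index. Both
    -- orders are moved to the increasing pair, where at most one survives because no vertex is on
    -- both sides. Edges of H are edges of G.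
    E≤crossNum : ∀ p q → E p q ≤ crossNum G π p q
    E≤crossNum p q = begin
      E p q
        ≤⟨ sum₂-mono split ⟩
      sum₂ (λ x y → bit (lt x y ∧ F x y) + bit (lt y x ∧ F x y))
        ≡⟨ sum₂-+ (λ x y → bit (lt x y ∧ F x y)) (λ x y → bit (lt y x ∧ F x y)) ⟩
      sum₂ (λ x y → bit (lt x y ∧ F x y)) + sum₂ (λ x y → bit (lt y x ∧ F x y))
        ≡⟨ cong (sum₂ (λ x y → bit (lt x y ∧ F x y)) +_) (sum-swap (λ x y → bit (lt y x ∧ F x y))) ⟩
      sum₂ (λ x y → bit (lt x y ∧ F x y)) + sum₂ (λ x y → bit (lt x y ∧ F y x))
        ≡⟨ sum₂-+ (λ x y → bit (lt x y ∧ F x y)) (λ x y → bit (lt x y ∧ F y x)) ⟨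
      sum₂ (λ x y → bit (lt x y ∧ F x y) + bit (lt x y ∧ F y x))
        ≤⟨ sum₂-mono merge ⟩
      sum₂ (λ x y → bit (lt x y ∧ C x y))
        ≡⟨ sum-cong (λ x → count≡sum (λ y → lt x y ∧ C x y)) ⟨
      crossNum G π p q ∎
      where
      open ≤-Reasoning
      lt F C : Fin n → Fin n → Bool
      lt x y = toℕ x <ᵇ toℕ y
      F x y  = hadj H x y ∧ across p q x y
      C x y  = adj G x y ∧ crosses π p q x y
      split : ∀ x y → bit (F x y) ≤ bit (lt x y ∧ F x y) + bit (lt y x ∧ F x y)
      split x y with F x y in e
      ... | false = z≤n
      ... | true with <-cmp (toℕ x) (toℕ y)
      ...   | tri< x<y _ _ rewrite <ᵇ-true x<y = s≤s z≤n
      ...   | tri> _ _ y<x rewrite <ᵇ-true y<x = m≤n+m 1 _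
      ...   | tri≈ _ x≡y _ = ⊥-elim (adj-distinct x y (proj₁ (∧-true e)) (toℕ-injective x≡y))
      merge : ∀ x y → bit (lt x y ∧ F x y) + bit (lt x y ∧ F y x) ≤ bit (lt x y ∧ C x y)
      merge x y with lt x y
      ... | false = z≤n
      ... | true with F x y in e | F y x in e′
      ...   | false | false = z≤n
      ...   | true  | false
        rewrite crossing-edge p q x y (proj₁ (∧-true e)) (proj₂ (∧-true {hadj H x y} e)) = ≤-refl
      ...   | false | true
        rewrite crossing-edge′ p q x y (proj₁ (∧-true e′)) (proj₂ (∧-true {hadj H y x} e′)) = ≤-refl
      ...   | true  | true  = ⊥-elim (Between-asym (pos π p) (pos π q) (pos π x)
        (proj₁ (across-between p q x y (proj₂ (∧-true {hadj H x y} e))))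
        (proj₂ (across-between p q y x (proj₂ (∧-true {hadj H y x} e′)))))

    inn : Fin n → Fin n → Fin n → Bool
    inn p q z = V z ∧ between p z q

    Balanced : Fin n → Fin n → Set
    Balanced p q = 3 * count (inn p q) ≤ 2 * W × 3 * count (inn q p) ≤ 2 * W

    Balanced? : ∀ p q → Dec (Balanced p q)
    Balanced? p q = (_ ≤? _) ×-dec (_ ≤? _)

    -- The separator consists of p, q and the ends on the p-to-q side of the edges crossing pq.
    chord-separates : ∀ {K} p q → ¬ p ≡ q → E p q < K → Balanced p q → Separates (suc K)
    chord-separates {K} p q p≢q E<K (pq≤ , qp≤) = separates a b (inn p q) (inn q p) sep
      cover (λ z → proj₁ ∘ ∧-true) (λ z → proj₁ ∘ ∧-true) no-edge
      (λ z az ¬bz → true-∧ (proj₁ (∧-true az)) (decidable-stable (Btw? p z q) λ ¬I →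
        ¬bz (true-∧ (proj₁ (∧-true az)) (true-∨ˡ (true-not ¬I))))) pq≤
      (λ z bz ¬az → true-∧ (proj₁ (∧-true bz)) (decidable-stable (Btw? q z p) λ ¬O →
        ¬az (true-∧ (proj₁ (∧-true bz)) (true-not ¬O)))) qp≤
      on-sep sep≤
      where
      Reaches? : ∀ z → Dec (∃ λ o → hadj H z o ≡ true × Btw q o p)
      Reaches? z = any? λ o → (hadj H z o Bool.≟ true) ×-dec Btw? q o p
      reaches a b sep crossing is-p is-q : Fin n → Bool
      reaches z  = does (Reaches? z)
      -- The first set omits the open arc from q to p; the second keeps, of the other open arc, only
      -- the vertices with a neighbour there.
      a z        = V z ∧ not (between q z p)
      b z        = V z ∧ (not (between p z q) ∨ reaches z)
      crossing z = between p z q ∧ reaches z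
      is-p z     = does (z Fin.≟ p)
      is-q z     = does (z Fin.≟ q)
      sep z      = is-p z ∨ (is-q z ∨ crossing z)

      cover : ∀ z → V z ≡ true → a z ≡ true ⊎ b z ≡ true
      cover z Vz with Btw? q z p
      ... | no ¬O = inj₁ (true-∧ Vz (true-not ¬O))
      ... | yes O = inj₂ (true-∧ Vz (true-∨ˡ (true-not λ I → Between-asym (pos π p) (pos π q) (pos π z) I O)))

      no-edge : ∀ u v → hadj H u v ≡ true → a u ≡ true → ¬ b u ≡ true → b v ≡ true → ¬ a v ≡ true → ⊥
      no-edge u v uv au ¬bu bv ¬av = ¬bu (true-∧ (proj₁ (∧-true au))
        (true-∨ʳ {not (between p u q)} (dec-true (Reaches? u) (v , uv ,
          decidable-stable (Btw? q v p) λ ¬O → ¬av (true-∧ (proj₁ (∧-true bv)) (true-not ¬O))))))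

      on-sep : ∀ z → a z ≡ true → b z ≡ true → sep z ≡ true
      on-sep z az bz with z Fin.≟ p
      ... | yes _ = refl
      ... | no z≢p with z Fin.≟ q
      ...   | yes _ = refl
      ...   | no z≢q = true-∧ I ([ (λ ¬I → ⊥-elim (not-true ¬I I)) , id ]′ (∨-true (proj₂ (∧-true {V z} bz))))
        where
        I : Btw p z q
        I = distinct-between (pos π p) (pos π q) (pos π z) (p≢q ∘ pos-injective) (z≢p ∘ pos-injective)
              (z≢q ∘ pos-injective) (not-true (proj₂ (∧-true {V z} az)))

      crossing≤ : count crossing ≤ E p q
      crossing≤ = ≤-trans (≤-reflexive (count≡sum crossing)) (sum-mono pointwise)
        where
        pointwise : ∀ z → bit (crossing z) ≤ sumFin λ o → bit (hadj H z o ∧ across p q z o)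
        pointwise z with between p z q | Reaches? z
        ... | false | _     = z≤n
        ... | true  | no _  = z≤n
        ... | true  | yes (o , zo , O) = ≤-trans
          (≤-reflexive (sym (cong bit (true-∧ zo O))))
          (term≤sum (λ o → bit (hadj H z o ∧ between q o p)) o)

      sep≤ : count sep ≤ suc K
      -- `p` accounts for the successor, and the strict inequality `E p q < K` leaves room for `q`.
      sep≤ = ≤-trans (count-∨ is-p (λ z → is-q z ∨ crossing z))
        (+-mono-≤ (count-unique p λ z → does-sound (z Fin.≟ p))
          (≤-trans (count-∨ is-q crossing)
            (≤-trans (+-mono-≤ (count-unique q λ z → does-sound (z Fin.≟ q)) crossing≤) E<K)))

    -- The open arc from q to p is disjoint from the closed arc from p to q and carries more than
    -- two thirds, leaving less than one third.
    unbalanced-small : ∀ p q → ¬ p ≡ q → ¬ 3 * count (inn q p) ≤ 2 * W → Small p q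
    unbalanced-small p q p≢q big = +-cancelʳ-< (2 * W) _ _ (begin-strict
      3 * count on + 2 * W               <⟨ +-monoʳ-< (3 * count on) (≰⇒> big) ⟩
      3 * count on + 3 * count (inn q p) ≡⟨ *-distribˡ-+ 3 (count on) (count (inn q p)) ⟨
      3 * (count on + count (inn q p))   ≤⟨ *-monoʳ-≤ 3 (count-+≤ on⊆V inn⊆V disjoint) ⟩
      3 * W                              ∎)
      where
      open ≤-Reasoning
      on : Fin n → Bool
      on z = V z ∧ arc p q z
      on⊆V : ∀ z → on z ≡ true → V z ≡ true
      on⊆V z = proj₁ ∘ ∧-true
      inn⊆V : ∀ z → inn q p z ≡ true → V z ≡ true
      inn⊆V z = proj₁ ∘ ∧-true
      disjoint : ∀ z → on z ≡ true → inn q p z ≡ true → ⊥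
      disjoint z h h′ = Between⇒¬In (pos π p) (pos π q) (pos π z)
        (proj₂ (∧-true {V z} h′)) (proj₂ (∧-true {V z} h))

    -- If no chord with fewer than K crossings is balanced, each such chord is too heavy on one
    -- side, so its other side is small, which is the hypothesis `total` of both contradictions.
    separation : ∀ K → 1 ≤ K →
      (Fin n → (∀ p q → E p q < K → Small p q ⊎ Small q p) → ⊥) → Separates (suc K)
    separation K 1≤K impossible with count V ≤? 3
    ... | yes W≤3 = few-vertices (s≤s 1≤K) W≤3
    ... | no W≰3 with any? (λ p → any? λ q → ¬? (p Fin.≟ q) ×-dec (E p q <? K) ×-dec Balanced? p q)
    ...   | yes (p , q , p≢q , E<K , bal) = chord-separates p q p≢q E<K bal
    ...   | no none = ⊥-elim (impossible vertex total)
      where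
      vertex : Fin n
      vertex = proj₁ (sum-positive (λ z → bit (V z))
        (subst (1 ≤_) (count≡sum V) (≤-trans (s≤s z≤n) (≰⇒> W≰3))))
      total : ∀ p q → E p q < K → Small p q ⊎ Small q p
      total p q E<K with p Fin.≟ q
      -- Degenerate chords are included; they need at least four vertices.
      ... | yes refl = inj₁ (Small-singleton (≰⇒> W≰3) p)
      ... | no p≢q with 3 * count (inn p q) ≤? 2 * W
      ...   | no big = inj₂ (unbalanced-small q p (p≢q ∘ sym) big)
      ...   | yes le = inj₁ (unbalanced-small p q p≢q λ le′ → none (p , q , p≢q , E<K , le , le′))

theorem16 :
    ((k n : ℕ) (G : Graph n) → OuterKPlanar k G → SepNumAtMost (k + 2) G) ×
    ((k : ℕ) → 1 ≤ k → (n : ℕ) (G : Graph n) → OuterMinKPlanar k G →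
      SepNumAtMost (2 * k + 1) G)
theorem16 = kPlanar , minKPlanar
  where
  kPlanar : ∀ k n (G : Graph n) → OuterKPlanar k G → SepNumAtMost (k + 2) G
  -- With K = k + 1, fewer than K crossings means at most k, and the order is K + 1 = k + 2.
  kPlanar k n G (π , few) H = subst Separates (+-comm 2 k) (separation (suc k) (s≤s z≤n) λ z₀ total →
    NoSeparator.kPlanar-impossible (pos π) pos-injective V (hadj H) (hsym H) hadj-irrefl z₀ k
      (λ x y xy → ≤-trans (E≤crossNum x y) (few x y (hsub H x y xy))) total)
    where
    open OfSubgraph H
    open Drawn π

  minKPlanar : ∀ k → 1 ≤ k → ∀ n (G : Graph n) → OuterMinKPlanar k G → SepNumAtMost (2 * k + 1) G
  minKPlanar k 1≤k n G (π , few) H = subst Separates (+-comm 1 (2 * k))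
    -- Here K = 2k, so the order is 2k + 1.
    (separation (2 * k) (≤-trans 1≤k (m≤m+n k _)) λ z₀ total →
      NoSeparator.MinKPlanar.minKPlanar-impossible
        (pos π) pos-injective V (hadj H) (hsym H) hadj-irrefl z₀ k 1≤k
        (λ u v x y uv xy cross → Sum.map (≤-trans (E≤crossNum u v)) (≤-trans (E≤crossNum x y))
          (few u v x y (hsub H u v uv) (hsub H x y xy)
            (proj₂ (∧-true (crossing-edge u v x y xy cross)))))
        total)
    where
    open OfSubgraph H
    open Drawn π
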